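{- Let $\mathbf{A}_3$ be the minimal subalgebra of the full relation algebra on a 3-element set, and let $\operatorname{Var}(\mathbf{A}_3)$ be the variety it generates. Then $\operatorname{Var}(\mathbf{A}_3)$ has exactly $2^{\aleph_0}$ join-irreducible covers in each of the lattices $\boldsymbol{\Lambda}_{\mathrm{RSA}}$, $\boldsymbol{\Lambda}_{\mathrm{SA}}$ and $\boldsymbol{\Lambda}_{\mathrm{NA}}$ (the subvariety lattices of the varieties of reflexive subadditive symmetric semiassociative relation algebras, of semiassociative relation algebras, and of nonassociative relation algebras, respectively).
   Context: A nonassociative relation algebra is an algebra $\mathbf{A}=\langle A;\vee,\wedge,\cdot,{}',\breve{\ },0,1,e\rangle$ such that $\langle A;\vee,\wedge,{}',0,1\rangle$ is a Boolean algebra, $\cdot$ is a binary operation, $e$ is an identity element for $\cdot$, and for all $x,y,z\in A$ the triangle laws hold: $(x\cdot y)\wedge z=0 \iff (\breve{x}\cdot z)\wedge y=0\iff (z\cdot\breve{y})\wedge x=0$. It is semiassociative if it satisfies $(x\cdot 1)\cdot 1\approx x\cdot 1$; reflexive if $x\le x\cdot x$ for all $x$; symmetric if $\breve{x}\approx x$; subadditive if $x\cdot(x'\wedge y)\le x\vee y$ for all $x,y$. The classes of all nonassociative relation algebras, all semiassociative relation algebras, and all reflexive subadditive symmetric semiassociative relation algebras are varieties; their lattices of subvarieties are denoted $\boldsymbol{\Lambda}_{\mathrm{NA}}$, $\boldsymbol{\Lambda}_{\mathrm{SA}}$, $\boldsymbol{\Lambda}_{\mathrm{RSA}}$. The full relation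 algebra on a set $U$ is the algebra of all subsets of $U\times U$ with union, intersection, relational composition, complement, relational converse, $\varnothing$, $U\times U$ and the identity relation on $U$; its minimal subalgebra is the subalgebra generated by $\varnothing$. In a lattice, $b$ covers $a$ if $a<b$ and there is no $c$ with $a<c<b$; a non-bottom element $b$ is join-irreducible if $b=c\vee d$ implies $b=c$ or $b=d$. -}

module Defs where

open import Level using (0ℓ; _⊔_) renaming (suc to lsuc)
open import Data.Bool using (Bool; true; false; T; not; if_then_else_; _≟_)
  renaming (_∧_ to _∧ᵇ_; _∨_ to _∨ᵇ_)
import Data.Bool.Properties as 𝔹
open import Data.Fin using (Fin)
import Data.Fin as Fin
import Data.Fin.Properties as Fin
open import Data.Nat using (ℕ; zero; suc)
open import Data.Product using (∃; _×_; _,_; proj₁; proj₂)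
open import Data.Sum using (_⊎_; inj₁; inj₂; [_,_]′)
open import Data.Empty using (⊥)
open import Data.Unit using (⊤; tt)
open import Function using (_∘_; id)
open import Function.Bundles using (_⇔_; mk⇔; Equivalence; Bijection)
open import Function.Properties.Equivalence using ()
  renaming (sym to ⇔-sym; trans to ⇔-trans)
open import Relation.Nullary using (¬_; Dec; yes; no; does)
open import Relation.Nullary.Decidable using (from-yes; T?)
open import Relation.Unary using (Pred; _⊆_; ∅)
open import Relation.Binary using (Rel; IsEquivalence; Setoid)
open import Relation.Binary.Lattice using (BoundedLattice)
import Relation.Binary.Construct.On as On
import Relation.Binary.Construct.NonStrictToStrict as Strict
open import Relation.Binary.PropositionalEquality as ≡
  using (_≡_; refl; _→-setoid_)
import Relation.Binary.Reasoning.Setoid as SetoidReasoning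
import Algebra.Lattice.Structures as Lat
import Algebra.Lattice.Bundles as LatB
import Algebra.Lattice.Properties.BooleanAlgebra as BAProps
open import Algebra.Definitions using (Identity)

-- Equality is the setoid relation _≈_; no law beyond congruence is imposed.
record Algebra : Set₁ where
  infix  4 _≈_ _≤_
  infixr 6 _∨_
  infixr 7 _∧_
  infixl 8 _·_
  infix  9 _′ _˘
  field
    Carrier       : Set
    _≈_           : Rel Carrier 0ℓ
    isEquivalence : IsEquivalence _≈_
    _∨_ _∧_ _·_   : Carrier → Carrier → Carrier
    _′ _˘         : Carrier → Carrier
    𝟘 𝟙 e         : Carrier
    ∨-cong        : ∀ {x y u v} → x ≈ y → u ≈ v → x ∨ u ≈ y ∨ v
    ∧-cong        : ∀ {x y u v} → x ≈ y → u ≈ v → x ∧ u ≈ y ∧ v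
    ·-cong        : ∀ {x y u v} → x ≈ y → u ≈ v → x · u ≈ y · v
    ′-cong        : ∀ {x y} → x ≈ y → x ′ ≈ y ′
    ˘-cong        : ∀ {x y} → x ≈ y → x ˘ ≈ y ˘

  open IsEquivalence isEquivalence public using ()
    renaming (refl to ≈-refl; sym to ≈-sym; trans to ≈-trans)

  setoid : Setoid 0ℓ 0ℓ
  setoid = record { isEquivalence = isEquivalence }

  _≤_ : Rel Carrier 0ℓ
  x ≤ y = x ∧ y ≈ x

record IsNA (A : Algebra) : Set where
  open Algebra A
  field
    isBooleanAlgebra : Lat.IsBooleanAlgebra _≈_ _∨_ _∧_ _′ 𝟙 𝟘
    ·-identity       : Identity _≈_ e _·_
    triangle₁        : ∀ x y z → (x · y ∧ z ≈ 𝟘) ⇔ (x ˘ · z ∧ y ≈ 𝟘)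
    triangle₂        : ∀ x y z → (x ˘ · z ∧ y ≈ 𝟘) ⇔ (z · y ˘ ∧ x ≈ 𝟘)

record IsSA (A : Algebra) : Set where
  open Algebra A
  field
    isNA            : IsNA A
    semiassociative : ∀ x → (x · 𝟙) · 𝟙 ≈ x · 𝟙

record IsRSA (A : Algebra) : Set where
  open Algebra A
  field
    isSA        : IsSA A
    reflexive   : ∀ x → x ≤ x · x
    subadditive : ∀ x y → x · (x ′ ∧ y) ≤ x ∨ y
    symmetric   : ∀ x → x ˘ ≈ x

infixr 6 _∨ₜ_
infixr 7 _∧ₜ_
infixl 8 _·ₜ_
infix  9 _′ₜ _˘ₜ

data Term : Set where
  var              : ℕ → Term
  _∨ₜ_ _∧ₜ_ _·ₜ_   : Term → Term → Term
  _′ₜ _˘ₜ          : Term → Term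
  𝟘ₜ 𝟙ₜ eₜ         : Term

-- A set of identities; E s t means that s ≈ t belongs to E.
Identities : Set₁
Identities = Rel Term 0ℓ

eval : (A : Algebra) → (ℕ → Algebra.Carrier A) → Term → Algebra.Carrier A
eval A v (var i)  = v i
eval A v (s ∨ₜ t) = Algebra._∨_ A (eval A v s) (eval A v t)
eval A v (s ∧ₜ t) = Algebra._∧_ A (eval A v s) (eval A v t)
eval A v (s ·ₜ t) = Algebra._·_ A (eval A v s) (eval A v t)
eval A v (s ′ₜ)   = Algebra._′ A (eval A v s)
eval A v (s ˘ₜ)   = Algebra._˘ A (eval A v s)
eval A v 𝟘ₜ       = Algebra.𝟘 A
eval A v 𝟙ₜ       = Algebra.𝟙 A
eval A v eₜ       = Algebra.e A

Id : Algebra → Identities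
Id A s t = ∀ v → Algebra._≈_ A (eval A v s) (eval A v t)

infix 4 _⊨_
_⊨_ : Algebra → Identities → Set
A ⊨ E = ∀ s t → E s t → Id A s t

subst : (ℕ → Term) → Term → Term
subst σ (var i)  = σ i
subst σ (s ∨ₜ t) = subst σ s ∨ₜ subst σ t
subst σ (s ∧ₜ t) = subst σ s ∧ₜ subst σ t
subst σ (s ·ₜ t) = subst σ s ·ₜ subst σ t
subst σ (s ′ₜ)   = subst σ s ′ₜ
subst σ (s ˘ₜ)   = subst σ s ˘ₜ
subst σ 𝟘ₜ       = 𝟘ₜ
subst σ 𝟙ₜ       = 𝟙ₜ
subst σ eₜ       = eₜ

data Derivable (E : Identities) : Identities where
  axiom  : ∀ {s t} → E s t → ∀ σ → Derivable E (subst σ s) (subst σ t)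
  drefl  : ∀ {s} → Derivable E s s
  dsym   : ∀ {s t} → Derivable E s t → Derivable E t s
  dtrans : ∀ {s t u} → Derivable E s t → Derivable E t u → Derivable E s u
  d∨     : ∀ {s t u w} → Derivable E s t → Derivable E u w →
           Derivable E (s ∨ₜ u) (t ∨ₜ w)
  d∧     : ∀ {s t u w} → Derivable E s t → Derivable E u w →
           Derivable E (s ∧ₜ u) (t ∧ₜ w)
  d·     : ∀ {s t u w} → Derivable E s t → Derivable E u w →
           Derivable E (s ·ₜ u) (t ·ₜ w)
  d′     : ∀ {s t} → Derivable E s t → Derivable E (s ′ₜ) (t ′ₜ)
  d˘     : ∀ {s t} → Derivable E s t → Derivable E (s ˘ₜ) (t ˘ₜ)

eval-subst : ∀ A v σ t → Algebra._≈_ A (eval A v (subst σ t))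
                                       (eval A (eval A v ∘ σ) t)
eval-subst A v σ (var i)  = Algebra.≈-refl A
eval-subst A v σ (s ∨ₜ t) = Algebra.∨-cong A (eval-subst A v σ s) (eval-subst A v σ t)
eval-subst A v σ (s ∧ₜ t) = Algebra.∧-cong A (eval-subst A v σ s) (eval-subst A v σ t)
eval-subst A v σ (s ·ₜ t) = Algebra.·-cong A (eval-subst A v σ s) (eval-subst A v σ t)
eval-subst A v σ (s ′ₜ)   = Algebra.′-cong A (eval-subst A v σ s)
eval-subst A v σ (s ˘ₜ)   = Algebra.˘-cong A (eval-subst A v σ s)
eval-subst A v σ 𝟘ₜ       = Algebra.≈-refl A
eval-subst A v σ 𝟙ₜ       = Algebra.≈-refl A
eval-subst A v σ eₜ       = Algebra.≈-refl A

soundness : ∀ A {E} → A ⊨ E → ∀ {s t} → Derivable E s t → Id A s t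
soundness A A⊨E (axiom {s} {t} h σ) v =
  Algebra.≈-trans A (eval-subst A v σ s)
    (Algebra.≈-trans A (A⊨E _ _ h (eval A v ∘ σ))
      (Algebra.≈-sym A (eval-subst A v σ t)))
soundness A A⊨E drefl v        = Algebra.≈-refl A
soundness A A⊨E (dsym p) v     = Algebra.≈-sym A (soundness A A⊨E p v)
soundness A A⊨E (dtrans p q) v =
  Algebra.≈-trans A (soundness A A⊨E p v) (soundness A A⊨E q v)
soundness A A⊨E (d∨ p q) v     = Algebra.∨-cong A (soundness A A⊨E p v) (soundness A A⊨E q v)
soundness A A⊨E (d∧ p q) v     = Algebra.∧-cong A (soundness A A⊨E p v) (soundness A A⊨E q v)
soundness A A⊨E (d· p q) v     = Algebra.·-cong A (soundness A A⊨E p v) (soundness A A⊨E q v)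
soundness A A⊨E (d′ p) v       = Algebra.′-cong A (soundness A A⊨E p v)
soundness A A⊨E (d˘ p) v       = Algebra.˘-cong A (soundness A A⊨E p v)

-- The free algebra on countably many generators in the variety defined by E.
Free : Identities → Algebra
Free E = record
  { Carrier = Term
  ; _≈_ = Derivable E
  ; isEquivalence = record { refl = drefl ; sym = dsym ; trans = dtrans }
  ; _∨_ = _∨ₜ_ ; _∧_ = _∧ₜ_ ; _·_ = _·ₜ_ ; _′ = _′ₜ ; _˘ = _˘ₜ
  ; 𝟘 = 𝟘ₜ ; 𝟙 = 𝟙ₜ ; e = eₜ
  ; ∨-cong = d∨ ; ∧-cong = d∧ ; ·-cong = d· ; ′-cong = d′ ; ˘-cong = d˘
  }

eval-Free : ∀ E σ t → eval (Free E) σ t ≡ subst σ t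
eval-Free E σ (var i)  = refl
eval-Free E σ (s ∨ₜ t) = ≡.cong₂ _∨ₜ_ (eval-Free E σ s) (eval-Free E σ t)
eval-Free E σ (s ∧ₜ t) = ≡.cong₂ _∧ₜ_ (eval-Free E σ s) (eval-Free E σ t)
eval-Free E σ (s ·ₜ t) = ≡.cong₂ _·ₜ_ (eval-Free E σ s) (eval-Free E σ t)
eval-Free E σ (s ′ₜ)   = ≡.cong _′ₜ (eval-Free E σ s)
eval-Free E σ (s ˘ₜ)   = ≡.cong _˘ₜ (eval-Free E σ s)
eval-Free E σ 𝟘ₜ       = refl
eval-Free E σ 𝟙ₜ       = refl
eval-Free E σ eₜ       = refl

Free⊨ : ∀ E → Free E ⊨ E
Free⊨ E s t h σ =
  ≡.subst₂ (Derivable E) (≡.sym (eval-Free E σ s)) (≡.sym (eval-Free E σ t)) (axiom h σ)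

subst-var : ∀ t → subst var t ≡ t
subst-var (var i)  = refl
subst-var (s ∨ₜ t) = ≡.cong₂ _∨ₜ_ (subst-var s) (subst-var t)
subst-var (s ∧ₜ t) = ≡.cong₂ _∧ₜ_ (subst-var s) (subst-var t)
subst-var (s ·ₜ t) = ≡.cong₂ _·ₜ_ (subst-var s) (subst-var t)
subst-var (s ′ₜ)   = ≡.cong _′ₜ (subst-var s)
subst-var (s ˘ₜ)   = ≡.cong _˘ₜ (subst-var s)
subst-var 𝟘ₜ       = refl
subst-var 𝟙ₜ       = refl
subst-var eₜ       = refl

completeness : ∀ E {s t} → Id (Free E) s t → Derivable E s t
completeness E {s} {t} h =
  ≡.subst₂ (Derivable E)
    (≡.trans (eval-Free E var s) (subst-var s))
    (≡.trans (eval-Free E var t) (subst-var t))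
    (h var)

-- A variety is a class of algebras that is axiomatised by some set of
-- identities.  Varieties are compared by their members only, so the choice
-- of basis is irrelevant.
record Variety : Set₁ where
  field
    Member    : Pred Algebra 0ℓ
    basis     : Identities
    definable : ∀ A → Member A ⇔ A ⊨ basis

  toBasis : ∀ {A} → Member A → A ⊨ basis
  toBasis {A} = Equivalence.to (definable A)

  fromBasis : ∀ {A} → A ⊨ basis → Member A
  fromBasis {A} = Equivalence.from (definable A)

open Variety public using (Member)

Mod : Identities → Variety
Mod E = record
  { Member = _⊨ E ; basis = E ; definable = λ A → mk⇔ id id }

infix 4 _⊑_ _≋_
_⊑_ : Rel Variety (lsuc 0ℓ)
V ⊑ W = Member V ⊆ Member W

_≋_ : Rel Variety (lsuc 0ℓ)
V ≋ W = V ⊑ W × W ⊑ V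

-- Var-member and Var-least below show that this is the least variety
-- containing A.
Var : Algebra → Variety
Var A = Mod (Id A)

Var-member : ∀ A → Member (Var A) A
Var-member A s t = id

Var-least : ∀ A W → Member W A → Var A ⊑ W
Var-least A W A∈W B⊨ =
  Variety.fromBasis W (λ s t h → B⊨ s t (Variety.toBasis W A∈W s t h))

-- The identities of a join are those valid in both varieties; "valid in V"
-- is expressed by derivability, which keeps the basis small.
_⊔ᵥ_ : Variety → Variety → Variety
V ⊔ᵥ W = Mod λ s t → Derivable (Variety.basis V) s t × Derivable (Variety.basis W) s t

_⊓ᵥ_ : Variety → Variety → Variety
V ⊓ᵥ W = record
  { Member    = λ A → Member V A × Member W A
  ; basis     = λ s t → Variety.basis V s t ⊎ Variety.basis W s t
  ; definable = λ A → mk⇔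
      (λ (p , q) s t → [ Variety.toBasis V p s t , Variety.toBasis W q s t ]′)
      (λ h → Variety.fromBasis V (λ s t → h s t ∘ inj₁) , Variety.fromBasis W (λ s t → h s t ∘ inj₂))
  }

Trivial : Variety
Trivial = record
  { Member    = λ A → ∀ x y → Algebra._≈_ A x y
  ; basis     = λ _ _ → ⊤
  ; definable = λ A → mk⇔ (λ h s t _ v → h (eval A v s) (eval A v t))
      (λ h x y → h (var 0) (var 1) tt λ { zero → x ; (suc _) → y })
  }

⊔ᵥ-upperˡ : ∀ V W → V ⊑ V ⊔ᵥ W
⊔ᵥ-upperˡ V W {A} A∈V _ _ (p , _) = soundness A (Variety.toBasis V A∈V) p

⊔ᵥ-upperʳ : ∀ V W → W ⊑ V ⊔ᵥ W
⊔ᵥ-upperʳ V W {A} A∈W _ _ (_ , q) = soundness A (Variety.toBasis W A∈W) q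

⊔ᵥ-least : ∀ V W U → V ⊑ U → W ⊑ U → V ⊔ᵥ W ⊑ U
⊔ᵥ-least V W U V⊑U W⊑U A⊨ = Variety.fromBasis U λ s t h →
  A⊨ s t (consequence V V⊑U h , consequence W W⊑U h)
  where
  consequence : ∀ X → X ⊑ U → ∀ {s t} → Variety.basis U s t →
                Derivable (Variety.basis X) s t
  consequence X X⊑U h = completeness E
    (Variety.toBasis U (X⊑U {Free E} (Variety.fromBasis X (Free⊨ E))) _ _ h)
    where E = Variety.basis X

SubvarietyLattice : Variety → BoundedLattice (lsuc 0ℓ) (lsuc 0ℓ) (lsuc 0ℓ)
SubvarietyLattice W = record
  { Carrier = ∃ λ V → V ⊑ W
  ; _≈_ = λ (V₁ , _) (V₂ , _) → V₁ ≋ V₂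
  ; _≤_ = λ (V₁ , _) (V₂ , _) → V₁ ⊑ V₂
  ; _∨_ = λ (V₁ , p) (V₂ , q) → V₁ ⊔ᵥ V₂ , λ {A} → ⊔ᵥ-least V₁ V₂ W p q {A}
  ; _∧_ = λ (V₁ , p) (V₂ , _) → V₁ ⊓ᵥ V₂ , p ∘ proj₁
  ; ⊤ = W , id
  ; ⊥ = Trivial , λ {A} → trivial⊑ W {A}
  ; isBoundedLattice = record
    { isLattice = record
      { isPartialOrder = record
        { isPreorder = record
          { isEquivalence = record
            { refl  = id , id
            ; sym   = λ (p , q) → q , p
            ; trans = λ (p , q) (r , s) → r ∘ p , q ∘ s
            }
          ; reflexive = proj₁
          ; trans     = λ p q → q ∘ p
          }
        ; antisym = λ p q → p , q
        }
      ; supremum = λ (V₁ , _) (V₂ , _) →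
          (λ {A} → ⊔ᵥ-upperˡ V₁ V₂ {A}) , (λ {A} → ⊔ᵥ-upperʳ V₁ V₂ {A}) ,
          λ (U , _) p q {A} → ⊔ᵥ-least V₁ V₂ U p q {A}
      ; infimum = λ _ _ → proj₁ , proj₂ , λ _ p q A∈U → p A∈U , q A∈U
      }
    ; maximum = proj₂
    ; minimum = λ (V , _) {A} → trivial⊑ V {A}
    }
  }
  where
  trivial⊑ : ∀ V → Trivial ⊑ V
  trivial⊑ V {A} h = Variety.fromBasis V {A} λ _ _ _ _ → h _ _

module _ {c ℓ₁ ℓ₂} (L : BoundedLattice c ℓ₁ ℓ₂) where
  open BoundedLattice L using (Carrier; _≈_; _≤_; _∨_)
    renaming (⊥ to bottom; setoid to L-setoid)
  open Strict _≈_ _≤_ using (_<_)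

  _Covers_ : Rel Carrier (c ⊔ ℓ₁ ⊔ ℓ₂)
  b Covers a = a < b × ¬ ∃ λ x → a < x × x < b

  JoinIrreducible : Pred Carrier (c ⊔ ℓ₁)
  JoinIrreducible b = ¬ b ≈ bottom × (∀ x y → b ≈ x ∨ y → b ≈ x ⊎ b ≈ y)

  JoinIrreducibleCovers : Carrier → Setoid (c ⊔ ℓ₁ ⊔ ℓ₂) ℓ₁
  JoinIrreducibleCovers a =
    On.setoid {B = ∃ λ b → b Covers a × JoinIrreducible b} L-setoid proj₁

-- S has exactly 2^ℵ₀ elements: it is in bijection with the 0-1 sequences,
-- which are compared pointwise.
HasCardinalityContinuum : ∀ {a ℓ} → Setoid a ℓ → Set (a ⊔ ℓ)
HasCardinalityContinuum S = Bijection S (ℕ →-setoid Bool)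

private
  pattern X = var 0
  pattern Y = var 1
  pattern Z = var 2

-- The last six identities replace the triangle laws.
data NA-identities : Identities where
  comm-∨  : NA-identities (X ∨ₜ Y) (Y ∨ₜ X)
  assoc-∨ : NA-identities ((X ∨ₜ Y) ∨ₜ Z) (X ∨ₜ (Y ∨ₜ Z))
  comm-∧  : NA-identities (X ∧ₜ Y) (Y ∧ₜ X)
  assoc-∧ : NA-identities ((X ∧ₜ Y) ∧ₜ Z) (X ∧ₜ (Y ∧ₜ Z))
  absorb₁ : NA-identities (X ∨ₜ (X ∧ₜ Y)) X
  absorb₂ : NA-identities (X ∧ₜ (X ∨ₜ Y)) X
  distr₁  : NA-identities (X ∨ₜ (Y ∧ₜ Z)) ((X ∨ₜ Y) ∧ₜ (X ∨ₜ Z))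
  distr₂  : NA-identities ((Y ∧ₜ Z) ∨ₜ X) ((Y ∨ₜ X) ∧ₜ (Z ∨ₜ X))
  distr₃  : NA-identities (X ∧ₜ (Y ∨ₜ Z)) ((X ∧ₜ Y) ∨ₜ (X ∧ₜ Z))
  distr₄  : NA-identities ((Y ∨ₜ Z) ∧ₜ X) ((Y ∧ₜ X) ∨ₜ (Z ∧ₜ X))
  compl₁  : NA-identities (X ′ₜ ∨ₜ X) 𝟙ₜ
  compl₂  : NA-identities (X ∨ₜ X ′ₜ) 𝟙ₜ
  compl₃  : NA-identities (X ′ₜ ∧ₜ X) 𝟘ₜ
  compl₄  : NA-identities (X ∧ₜ X ′ₜ) 𝟘ₜ
  identˡ  : NA-identities (eₜ ·ₜ X) X
  identʳ  : NA-identities (X ·ₜ eₜ) X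
  ·-∨ˡ    : NA-identities (X ·ₜ (Y ∨ₜ Z)) ((X ·ₜ Y) ∨ₜ (X ·ₜ Z))
  ·-∨ʳ    : NA-identities ((Y ∨ₜ Z) ·ₜ X) ((Y ·ₜ X) ∨ₜ (Z ·ₜ X))
  tri₁    : NA-identities ((X ˘ₜ ·ₜ (X ·ₜ Y) ′ₜ) ∧ₜ Y) 𝟘ₜ
  tri₂    : NA-identities ((X ·ₜ (X ˘ₜ ·ₜ Z) ′ₜ) ∧ₜ Z) 𝟘ₜ
  tri₃    : NA-identities (((X ·ₜ Y) ′ₜ ·ₜ Y ˘ₜ) ∧ₜ X) 𝟘ₜ
  tri₄    : NA-identities (((Z ·ₜ Y ˘ₜ) ′ₜ ·ₜ Y) ∧ₜ Z) 𝟘ₜ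

data SA-identities : Identities where
  na       : ∀ {s t} → NA-identities s t → SA-identities s t
  semi     : SA-identities ((X ·ₜ 𝟙ₜ) ·ₜ 𝟙ₜ) (X ·ₜ 𝟙ₜ)

data RSA-identities : Identities where
  sa       : ∀ {s t} → SA-identities s t → RSA-identities s t
  reflex   : RSA-identities (X ∧ₜ (X ·ₜ X)) X
  subadd   : RSA-identities ((X ·ₜ (X ′ₜ ∧ₜ Y)) ∧ₜ (X ∨ₜ Y)) (X ·ₜ (X ′ₜ ∧ₜ Y))
  symm     : RSA-identities (X ˘ₜ) X

private
  env : ∀ {A : Set} → A → A → A → ℕ → A
  env x y z 0 = x
  env x y z 1 = y
  env x y z (suc (suc _)) = z

  module BooleanLemmas (A : Algebra) where
    open Algebra A

    module _ (isBA : Lat.IsBooleanAlgebra _≈_ _∨_ _∧_ _′ 𝟙 𝟘) where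
      private
        BA : LatB.BooleanAlgebra 0ℓ 0ℓ
        BA = record { isBooleanAlgebra = isBA }
      open Lat.IsBooleanAlgebra isBA public using
        (∧-comm; ∨-comm; ∧-distribˡ-∨; ∧-distribʳ-∨; ∨-distribˡ-∧; ∨-complementʳ
        ; ∨-complementˡ; ∧-complementʳ; ∧-absorbs-∨)
      open BAProps BA using (∨-identityʳ; ∧-identityʳ; ∧-zeroʳ)
      open SetoidReasoning setoid

      ∨-zeroˡ⁻ : ∀ {x y} → x ∨ y ≈ 𝟘 → x ≈ 𝟘
      ∨-zeroˡ⁻ {x} {y} p = begin
        x           ≈⟨ ∧-absorbs-∨ x y ⟨
        x ∧ (x ∨ y) ≈⟨ ∧-cong ≈-refl p ⟩
        x ∧ 𝟘       ≈⟨ ∧-zeroʳ x ⟩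
        𝟘           ∎

      ∨-zeroʳ⁻ : ∀ {x y} → x ∨ y ≈ 𝟘 → y ≈ 𝟘
      ∨-zeroʳ⁻ {x} {y} p = ∨-zeroˡ⁻ (≈-trans (∨-comm y x) p)

      ∨-zero⁺ : ∀ {x y} → x ≈ 𝟘 → y ≈ 𝟘 → x ∨ y ≈ 𝟘
      ∨-zero⁺ p q = ≈-trans (∨-cong p q) (∨-identityʳ 𝟘)

      split : ∀ {x y z} → (x ∧ (y ∨ z) ≈ 𝟘) ⇔ (x ∧ y ≈ 𝟘 × x ∧ z ≈ 𝟘)
      split {x} {y} {z} = mk⇔
        (λ p → let q = ≈-trans (≈-sym (∧-distribˡ-∨ x y z)) p in ∨-zeroˡ⁻ q , ∨-zeroʳ⁻ q)
        (λ (p , q) → ≈-trans (∧-distribˡ-∨ x y z) (∨-zero⁺ p q))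

      splitʳ : ∀ {x y z} → ((y ∨ z) ∧ x ≈ 𝟘) ⇔ (y ∧ x ≈ 𝟘 × z ∧ x ≈ 𝟘)
      splitʳ {x} {y} {z} = mk⇔
        (λ p → let q = ≈-trans (≈-sym (∧-distribʳ-∨ x y z)) p in ∨-zeroˡ⁻ q , ∨-zeroʳ⁻ q)
        (λ (p , q) → ≈-trans (∧-distribʳ-∨ x y z) (∨-zero⁺ p q))

      below : ∀ {x y} → x ∧ y ′ ≈ 𝟘 → x ≈ x ∧ y
      below {x} {y} p = begin
        x                   ≈⟨ ∧-identityʳ x ⟨
        x ∧ 𝟙               ≈⟨ ∧-cong ≈-refl (∨-complementʳ y) ⟨
        x ∧ (y ∨ y ′)       ≈⟨ ∧-distribˡ-∨ x y (y ′) ⟩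
        x ∧ y ∨ x ∧ y ′     ≈⟨ ∨-cong ≈-refl p ⟩
        x ∧ y ∨ 𝟘           ≈⟨ ∨-identityʳ (x ∧ y) ⟩
        x ∧ y               ∎

      extensional : ∀ {x y} → (∀ w → (x ∧ w ≈ 𝟘) ⇔ (y ∧ w ≈ 𝟘)) → x ≈ y
      extensional {x} {y} h = begin
        x     ≈⟨ below (Equivalence.from (h (y ′)) (∧-complementʳ y)) ⟩
        x ∧ y ≈⟨ ∧-comm x y ⟩
        y ∧ x ≈⟨ below (Equivalence.to (h (x ′)) (∧-complementʳ x)) ⟨
        y     ∎

      complement-above : ∀ {x y} → x ∧ y ≈ 𝟘 → x ′ ∨ y ≈ x ′
      complement-above {x} {y} p = begin
        x ′ ∨ y                   ≈⟨ ∧-identityʳ _ ⟨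
        (x ′ ∨ y) ∧ 𝟙             ≈⟨ ∧-cong ≈-refl (∨-complementˡ x) ⟨
        (x ′ ∨ y) ∧ (x ′ ∨ x)     ≈⟨ ∨-distribˡ-∧ (x ′) y x ⟨
        x ′ ∨ y ∧ x               ≈⟨ ∨-cong ≈-refl (≈-trans (∧-comm y x) p) ⟩
        x ′ ∨ 𝟘                   ≈⟨ ∨-identityʳ (x ′) ⟩
        x ′                       ∎

  ×-⇔ : ∀ {A B C D : Set} → A ⇔ B → C ⇔ D → (A × C) ⇔ (B × D)
  ×-⇔ f g = mk⇔ (λ (a , c) → Equivalence.to f a , Equivalence.to g c)
                (λ (b , d) → Equivalence.from f b , Equivalence.from g d)

  NA⇒identities : ∀ {A} → IsNA A → A ⊨ NA-identities
  NA⇒identities {A} isNA = laws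
    where
    open Algebra A hiding (∨-cong; ∧-cong)
    open IsNA isNA
    module B = Lat.IsBooleanAlgebra isBooleanAlgebra
    open BooleanLemmas A
    open Equivalence using (to; from)

    triangle₁₃ : ∀ x y z → (x · y ∧ z ≈ 𝟘) ⇔ (z · y ˘ ∧ x ≈ 𝟘)
    triangle₁₃ x y z = ⇔-trans (triangle₁ x y z) (triangle₂ x y z)

    laws : A ⊨ NA-identities
    laws _ _ comm-∨ v  = B.∨-comm _ _
    laws _ _ assoc-∨ v = B.∨-assoc _ _ _
    laws _ _ comm-∧ v  = B.∧-comm _ _
    laws _ _ assoc-∧ v = B.∧-assoc _ _ _
    laws _ _ absorb₁ v = B.∨-absorbs-∧ _ _
    laws _ _ absorb₂ v = B.∧-absorbs-∨ _ _
    laws _ _ distr₁ v  = B.∨-distribˡ-∧ _ _ _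
    laws _ _ distr₂ v  = B.∨-distribʳ-∧ _ _ _
    laws _ _ distr₃ v  = B.∧-distribˡ-∨ _ _ _
    laws _ _ distr₄ v  = B.∧-distribʳ-∨ _ _ _
    laws _ _ compl₁ v  = B.∨-complementˡ _
    laws _ _ compl₂ v  = B.∨-complementʳ _
    laws _ _ compl₃ v  = B.∧-complementˡ _
    laws _ _ compl₄ v  = B.∧-complementʳ _
    laws _ _ identˡ v  = proj₁ ·-identity _
    laws _ _ identʳ v  = proj₂ ·-identity _
    laws _ _ ·-∨ˡ v    = extensional isBooleanAlgebra λ w →
      ⇔-trans (triangle₁ _ _ w) (⇔-trans (split isBooleanAlgebra)
        (⇔-trans (×-⇔ (⇔-sym (triangle₁ _ _ w)) (⇔-sym (triangle₁ _ _ w)))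
          (⇔-sym (splitʳ isBooleanAlgebra))))
    laws _ _ ·-∨ʳ v    = extensional isBooleanAlgebra λ w →
      ⇔-trans (triangle₁₃ _ _ w) (⇔-trans (split isBooleanAlgebra)
        (⇔-trans (×-⇔ (⇔-sym (triangle₁₃ _ _ w)) (⇔-sym (triangle₁₃ _ _ w)))
          (⇔-sym (splitʳ isBooleanAlgebra))))
    laws _ _ tri₁ v    = to (triangle₁ _ _ _) (B.∧-complementʳ _)
    laws _ _ tri₂ v    = from (triangle₁ _ _ _) (B.∧-complementʳ _)
    laws _ _ tri₃ v    = to (triangle₁₃ _ _ _) (B.∧-complementʳ _)
    laws _ _ tri₄ v    = from (triangle₁₃ _ _ _) (B.∧-complementʳ _)

  identities⇒NA : ∀ {A} → A ⊨ NA-identities → IsNA A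
  identities⇒NA {A} h = record
    { isBooleanAlgebra = isBA
    ; ·-identity = (λ x → h _ _ identˡ (env x x x)) , (λ x → h _ _ identʳ (env x x x))
    ; triangle₁  = λ x y z → mk⇔ (t₁ x y z) (t₂ x y z)
    ; triangle₂  = λ x y z → mk⇔ (t₃ x y z ∘ t₂ x y z) (t₁ x y z ∘ t₄ x y z)
    }
    where
    open Algebra A
    isBA : Lat.IsBooleanAlgebra _≈_ _∨_ _∧_ _′ 𝟙 𝟘
    isBA = record
      { isDistributiveLattice = record
        { isLattice = record
          { isEquivalence = isEquivalence
          ; ∨-comm     = λ x y → h _ _ comm-∨ (env x y y)
          ; ∨-assoc    = λ x y z → h _ _ assoc-∨ (env x y z)
          ; ∨-cong     = ∨-cong
          ; ∧-comm     = λ x y → h _ _ comm-∧ (env x y y)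
          ; ∧-assoc    = λ x y z → h _ _ assoc-∧ (env x y z)
          ; ∧-cong     = ∧-cong
          ; absorptive = (λ x y → h _ _ absorb₁ (env x y y)) , (λ x y → h _ _ absorb₂ (env x y y))
          }
        ; ∨-distrib-∧ = (λ x y z → h _ _ distr₁ (env x y z)) , (λ x y z → h _ _ distr₂ (env x y z))
        ; ∧-distrib-∨ = (λ x y z → h _ _ distr₃ (env x y z)) , (λ x y z → h _ _ distr₄ (env x y z))
        }
      ; ∨-complement = (λ x → h _ _ compl₁ (env x x x)) , (λ x → h _ _ compl₂ (env x x x))
      ; ∧-complement = (λ x → h _ _ compl₃ (env x x x)) , (λ x → h _ _ compl₄ (env x x x))
      ; ¬-cong       = ′-cong
      }
    open BooleanLemmas A
    open SetoidReasoning setoid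

    shrinkˡ : ∀ {p q r s} → p ∧ q ≈ 𝟘 → r · p ′ ∧ s ≈ 𝟘 → r · q ∧ s ≈ 𝟘
    shrinkˡ {p} {q} {r} {s} d k = ∨-zeroʳ⁻ isBA (begin
      r · p ′ ∧ s ∨ r · q ∧ s   ≈⟨ ∧-distribʳ-∨ isBA s (r · p ′) (r · q) ⟨
      (r · p ′ ∨ r · q) ∧ s     ≈⟨ ∧-cong (h _ _ ·-∨ˡ (env r (p ′) q)) ≈-refl ⟨
      r · (p ′ ∨ q) ∧ s         ≈⟨ ∧-cong (·-cong ≈-refl (complement-above isBA d)) ≈-refl ⟩
      r · p ′ ∧ s               ≈⟨ k ⟩
      𝟘                         ∎)

    shrinkʳ : ∀ {p q r s} → p ∧ q ≈ 𝟘 → p ′ · r ∧ s ≈ 𝟘 → q · r ∧ s ≈ 𝟘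
    shrinkʳ {p} {q} {r} {s} d k = ∨-zeroʳ⁻ isBA (begin
      p ′ · r ∧ s ∨ q · r ∧ s   ≈⟨ ∧-distribʳ-∨ isBA s (p ′ · r) (q · r) ⟨
      (p ′ · r ∨ q · r) ∧ s     ≈⟨ ∧-cong (h _ _ ·-∨ʳ (env r (p ′) q)) ≈-refl ⟨
      (p ′ ∨ q) · r ∧ s         ≈⟨ ∧-cong (·-cong (complement-above isBA d) ≈-refl) ≈-refl ⟩
      p ′ · r ∧ s               ≈⟨ k ⟩
      𝟘                         ∎)

    t₁ : ∀ x y z → x · y ∧ z ≈ 𝟘 → x ˘ · z ∧ y ≈ 𝟘
    t₁ x y z d = shrinkˡ d (h _ _ tri₁ (env x y z))
    t₂ : ∀ x y z → x ˘ · z ∧ y ≈ 𝟘 → x · y ∧ z ≈ 𝟘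
    t₂ x y z d = shrinkˡ d (h _ _ tri₂ (env x y z))
    t₃ : ∀ x y z → x · y ∧ z ≈ 𝟘 → z · y ˘ ∧ x ≈ 𝟘
    t₃ x y z d = shrinkʳ d (h _ _ tri₃ (env x y z))
    t₄ : ∀ x y z → z · y ˘ ∧ x ≈ 𝟘 → x · y ∧ z ≈ 𝟘
    t₄ x y z d = shrinkʳ d (h _ _ tri₄ (env x y z))

NA : Variety
NA = record
  { Member    = IsNA
  ; basis     = NA-identities
  ; definable = λ A → mk⇔ NA⇒identities identities⇒NA
  }

SA : Variety
SA = record
  { Member    = IsSA
  ; basis     = SA-identities
  ; definable = λ A → mk⇔
      (λ h → λ { _ _ (na p) → NA⇒identities (IsSA.isNA h) _ _ p
               ; _ _ semi v → IsSA.semiassociative h (v 0) })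
      (λ h → record { isNA = identities⇒NA (λ s t → h s t ∘ na)
                    ; semiassociative = λ x → h _ _ semi (env x x x) })
  }

RSA : Variety
RSA = record
  { Member    = IsRSA
  ; basis     = RSA-identities
  ; definable = λ A → mk⇔
      (λ h → λ { _ _ (sa p)   → Variety.toBasis SA (IsRSA.isSA h) _ _ p
               ; _ _ reflex v → IsRSA.reflexive h (v 0)
               ; _ _ subadd v → IsRSA.subadditive h (v 0) (v 1)
               ; _ _ symm v   → IsRSA.symmetric h (v 0) })
      (λ h → record { isSA        = Variety.fromBasis SA (λ s t → h s t ∘ sa)
                    ; reflexive   = λ x → h _ _ reflex (env x x x)
                    ; subadditive = λ x y → h _ _ subadd (env x y y)
                    ; symmetric   = λ x → h _ _ symm (env x x x) })
  }

Λ-NA Λ-SA Λ-RSA : BoundedLattice (lsuc 0ℓ) (lsuc 0ℓ) (lsuc 0ℓ)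
Λ-NA  = SubvarietyLattice NA
Λ-SA  = SubvarietyLattice SA
Λ-RSA = SubvarietyLattice RSA

module _ (A : Algebra) where
  open Algebra A

  data Generated (G : Pred Carrier 0ℓ) : Pred Carrier 0ℓ where
    gen  : ∀ {x} → G x → Generated G x
    resp : ∀ {x y} → x ≈ y → Generated G x → Generated G y
    g∨   : ∀ {x y} → Generated G x → Generated G y → Generated G (x ∨ y)
    g∧   : ∀ {x y} → Generated G x → Generated G y → Generated G (x ∧ y)
    g·   : ∀ {x y} → Generated G x → Generated G y → Generated G (x · y)
    g′   : ∀ {x} → Generated G x → Generated G (x ′)
    g˘   : ∀ {x} → Generated G x → Generated G (x ˘)
    g𝟘   : Generated G 𝟘
    g𝟙   : Generated G 𝟙
    ge   : Generated G e

  Subalgebra : Pred Carrier 0ℓ → Algebra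
  Subalgebra G = record
    { Carrier = ∃ (Generated G)
    ; _≈_ = λ (x , _) (y , _) → x ≈ y
    ; isEquivalence = On.isEquivalence proj₁ isEquivalence
    ; _∨_ = λ (x , p) (y , q) → x ∨ y , g∨ p q
    ; _∧_ = λ (x , p) (y , q) → x ∧ y , g∧ p q
    ; _·_ = λ (x , p) (y , q) → x · y , g· p q
    ; _′  = λ (x , p) → x ′ , g′ p
    ; _˘  = λ (x , p) → x ˘ , g˘ p
    ; 𝟘 = 𝟘 , g𝟘 ; 𝟙 = 𝟙 , g𝟙 ; e = e , ge
    ; ∨-cong = ∨-cong ; ∧-cong = ∧-cong ; ·-cong = ·-cong
    ; ′-cong = ′-cong ; ˘-cong = ˘-cong
    }

MinimalSubalgebra : Algebra → Algebra
MinimalSubalgebra A = Subalgebra A ∅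

-- Subsets of U × U, for U = Fin n, as characteristic functions.
Relation : ℕ → Set
Relation n = Fin n → Fin n → Bool

_⨾_ : ∀ {n} → Relation n → Relation n → Relation n
(R ⨾ S) x y = does (Fin.any? λ z → T? (R x z ∧ᵇ S z y))

private
  ⨾-to : ∀ {n} (R S : Relation n) {x y} → T ((R ⨾ S) x y) →
         ∃ λ z → T (R x z ∧ᵇ S z y)
  ⨾-to R S {x} {y} p with Fin.any? (λ z → T? (R x z ∧ᵇ S z y))
  ... | yes w = w

  ⨾-from : ∀ {n} (R S : Relation n) {x y} z → T (R x z ∧ᵇ S z y) → T ((R ⨾ S) x y)
  ⨾-from R S {x} {y} z p with Fin.any? (λ z → T? (R x z ∧ᵇ S z y))
  ... | yes w = tt
  ... | no ¬w = ¬w (z , p)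

  T-antisym : ∀ {a b} → (T a → T b) → (T b → T a) → a ≡ b
  T-antisym {true}  {true}  f g = refl
  T-antisym {true}  {false} f g with () ← f tt
  T-antisym {false} {true}  f g with () ← g tt
  T-antisym {false} {false} f g = refl

  ⨾-mono : ∀ {n} {R R₁ S S₁ : Relation n} → (∀ x y → R x y ≡ R₁ x y) →
           (∀ x y → S x y ≡ S₁ x y) → ∀ x y → T ((R ⨾ S) x y) → T ((R₁ ⨾ S₁) x y)
  ⨾-mono {R = R} {R₁} {S} {S₁} p q x y t with z , u ← ⨾-to R S t =
    ⨾-from R₁ S₁ z (≡.subst T (≡.cong₂ _∧ᵇ_ (p x z) (q z y)) u)

FullRelationAlgebra : ℕ → Algebra
FullRelationAlgebra n = record
  { Carrier = Relation n
  ; _≈_ = λ R S → ∀ x y → R x y ≡ S x y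
  ; isEquivalence = record
    { refl  = λ _ _ → refl
    ; sym   = λ p x y → ≡.sym (p x y)
    ; trans = λ p q x y → ≡.trans (p x y) (q x y)
    }
  ; _∨_ = λ R S x y → R x y ∨ᵇ S x y
  ; _∧_ = λ R S x y → R x y ∧ᵇ S x y
  ; _·_ = _⨾_
  ; _′  = λ R x y → not (R x y)
  ; _˘  = λ R x y → R y x
  ; 𝟘   = λ _ _ → false
  ; 𝟙   = λ _ _ → true
  ; e   = λ x y → does (x Fin.≟ y)
  ; ∨-cong = λ p q x y → ≡.cong₂ _∨ᵇ_ (p x y) (q x y)
  ; ∧-cong = λ p q x y → ≡.cong₂ _∧ᵇ_ (p x y) (q x y)
  ; ·-cong = λ p q x y → T-antisym
      (⨾-mono p q x y)
      (⨾-mono (λ x y → ≡.sym (p x y)) (λ x y → ≡.sym (q x y)) x y)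
  ; ′-cong = λ p x y → ≡.cong not (p x y)
  ; ˘-cong = λ p x y → p y x
  }

A₃ : Algebra
A₃ = MinimalSubalgebra (FullRelationAlgebra 3)

private
  FullRelationAlgebra-NA : ∀ n → IsNA (FullRelationAlgebra n)
  FullRelationAlgebra-NA n = record
    { isBooleanAlgebra = record
      { isDistributiveLattice = record
        { isLattice = record
          { isEquivalence = isEquivalence
          ; ∨-comm     = λ R S x y → B.∨-comm (R x y) (S x y)
          ; ∨-assoc    = λ R S Q x y → B.∨-assoc (R x y) (S x y) (Q x y)
          ; ∨-cong     = λ {R} {R′} {S} {S′} → ∨-cong {R} {R′} {S} {S′}
          ; ∧-comm     = λ R S x y → B.∧-comm (R x y) (S x y)
          ; ∧-assoc    = λ R S Q x y → B.∧-assoc (R x y) (S x y) (Q x y)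
          ; ∧-cong     = λ {R} {R′} {S} {S′} → ∧-cong {R} {R′} {S} {S′}
          ; absorptive = (λ R S x y → B.∨-absorbs-∧ (R x y) (S x y))
                       , (λ R S x y → B.∧-absorbs-∨ (R x y) (S x y))
          }
        ; ∨-distrib-∧ = (λ R S Q x y → B.∨-distribˡ-∧ (R x y) (S x y) (Q x y))
                      , (λ R S Q x y → B.∨-distribʳ-∧ (R x y) (S x y) (Q x y))
        ; ∧-distrib-∨ = (λ R S Q x y → B.∧-distribˡ-∨ (R x y) (S x y) (Q x y))
                      , (λ R S Q x y → B.∧-distribʳ-∨ (R x y) (S x y) (Q x y))
        }
      ; ∨-complement = (λ R x y → B.∨-complementˡ (R x y))
                     , (λ R x y → B.∨-complementʳ (R x y))
      ; ∧-complement = (λ R x y → B.∧-complementˡ (R x y))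
                     , (λ R x y → B.∧-complementʳ (R x y))
      ; ¬-cong       = λ {R} {S} → ′-cong {R} {S}
      }
    ; ·-identity = identityˡ , identityʳ
    ; triangle₁  = λ R S Q → mk⇔
        (λ h → from (R ˘) Q S λ x z y r q s → to R S Q h z x y r s q)
        (λ h → from R S Q λ x z y r s q → to (R ˘) Q S h z x y r q s)
    ; triangle₂  = λ R S Q → mk⇔
        (λ h → from Q (S ˘) R λ x z y q s r → to (R ˘) Q S h y x z r q s)
        (λ h → from (R ˘) Q S λ x z y r q s → to Q (S ˘) R h z y x q s r)
    }
    where
    open Algebra (FullRelationAlgebra n)
    module B = Lat.IsBooleanAlgebra 𝔹.∨-∧-isBooleanAlgebra

    Empty : Relation n → Relation n → Relation n → Set
    Empty R S Q = ∀ x z y → T (R x z) → T (S z y) → T (Q x y) → ⊥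

    pair : ∀ {a b} → T a → T b → T (a ∧ᵇ b)
    pair {true} {true} _ _ = tt

    unpair : ∀ {a b} → T (a ∧ᵇ b) → T a × T b
    unpair {true} {true} _ = tt , tt

    to : ∀ R S Q → (R · S) ∧ Q ≈ 𝟘 → Empty R S Q
    to R S Q h x z y r s q =
      ≡.subst T (h x y) (pair {(R ⨾ S) x y} (⨾-from R S z (pair {R x z} r s)) q)

    from : ∀ R S Q → Empty R S Q → (R · S) ∧ Q ≈ 𝟘
    from R S Q h x y = T-antisym
      (λ t → let p , q = unpair {(R ⨾ S) x y} t
                 z , u = ⨾-to R S {x} {y} p
                 r , s = unpair {R x z} u
             in h x z y r s q)
      λ ()

    diagonal : ∀ (x : Fin n) → T (e x x)
    diagonal x with x Fin.≟ x
    ... | yes _  = tt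
    ... | no x≢x = x≢x refl

    diagonal⁻ : ∀ {x y : Fin n} → T (e x y) → x ≡ y
    diagonal⁻ {x} {y} t with yes p ← x Fin.≟ y = p

    identityˡ : ∀ R → e · R ≈ R
    identityˡ R x y = T-antisym
      (λ t → let z , u = ⨾-to e R {x} {y} t
                 p , r = unpair {e x z} u
             in ≡.subst (λ x → T (R x y)) (≡.sym (diagonal⁻ p)) r)
      (λ t → ⨾-from e R {x} {y} x (pair {e x x} (diagonal x) t))

    identityʳ : ∀ R → R · e ≈ R
    identityʳ R x y = T-antisym
      (λ t → let z , u = ⨾-to R e {x} {y} t
                 r , p = unpair {R x z} u
             in ≡.subst (λ y → T (R x y)) (diagonal⁻ p) r)
      (λ t → ⨾-from R e {x} {y} y (pair {R x y} t (diagonal y)))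

  eval-Subalgebra : ∀ A G v t →
    proj₁ (eval (Subalgebra A G) v t) ≡ eval A (proj₁ ∘ v) t
  eval-Subalgebra A G v (var i)  = refl
  eval-Subalgebra A G v (s ∨ₜ t) =
    ≡.cong₂ (Algebra._∨_ A) (eval-Subalgebra A G v s) (eval-Subalgebra A G v t)
  eval-Subalgebra A G v (s ∧ₜ t) =
    ≡.cong₂ (Algebra._∧_ A) (eval-Subalgebra A G v s) (eval-Subalgebra A G v t)
  eval-Subalgebra A G v (s ·ₜ t) =
    ≡.cong₂ (Algebra._·_ A) (eval-Subalgebra A G v s) (eval-Subalgebra A G v t)
  eval-Subalgebra A G v (s ′ₜ)   = ≡.cong (Algebra._′ A) (eval-Subalgebra A G v s)
  eval-Subalgebra A G v (s ˘ₜ)   = ≡.cong (Algebra._˘ A) (eval-Subalgebra A G v s)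
  eval-Subalgebra A G v 𝟘ₜ       = refl
  eval-Subalgebra A G v 𝟙ₜ       = refl
  eval-Subalgebra A G v eₜ       = refl

  Subalgebra-Id : ∀ A G {s t} →
    (∀ v → (∀ i → Generated A G (v i)) → Algebra._≈_ A (eval A v s) (eval A v t)) →
    Id (Subalgebra A G) s t
  Subalgebra-Id A G {s} {t} h v =
    ≡.subst₂ (Algebra._≈_ A) (≡.sym (eval-Subalgebra A G v s))
      (≡.sym (eval-Subalgebra A G v t)) (h (proj₁ ∘ v) (proj₂ ∘ v))

  module Elements where
    open Algebra (FullRelationAlgebra 3)

    rep : Bool → Bool → Relation 3
    rep a b x y = if does (x Fin.≟ y) then a else b

    ∀ᵇ? : {P : Bool → Set} → (∀ b → Dec (P b)) → Dec (∀ b → P b)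
    ∀ᵇ? P? with P? true | P? false
    ... | yes p | yes q = yes λ { true → p ; false → q }
    ... | no ¬p | _     = no λ h → ¬p (h true)
    ... | _     | no ¬q = no λ h → ¬q (h false)

    ≈? : ∀ R S → Dec (R ≈ S)
    ≈? R S = Fin.all? λ x → Fin.all? λ y → R x y ≟ S x y

    pointwise : ∀ {f : Bool → Bool → Bool} a b c d →
      (λ x y → f (rep a b x y) (rep c d x y)) ≈ rep (f a c) (f b d)
    pointwise a b c d x y with does (x Fin.≟ y)
    ... | true  = refl
    ... | false = refl

    complement : ∀ a b → rep a b ′ ≈ rep (not a) (not b)
    complement a b x y with does (x Fin.≟ y)
    ... | true  = refl
    ... | false = refl

    compose : ∀ a b c d → rep a b · rep c d ≈
              rep ((a ∧ᵇ c) ∨ᵇ (b ∧ᵇ d)) ((a ∧ᵇ d) ∨ᵇ ((b ∧ᵇ c) ∨ᵇ (b ∧ᵇ d)))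
    compose = from-yes (∀ᵇ? λ a → ∀ᵇ? λ b → ∀ᵇ? λ c → ∀ᵇ? λ d →
      ≈? (rep a b · rep c d)
         (rep ((a ∧ᵇ c) ∨ᵇ (b ∧ᵇ d)) ((a ∧ᵇ d) ∨ᵇ ((b ∧ᵇ c) ∨ᵇ (b ∧ᵇ d)))))

    converse : ∀ a b → rep a b ˘ ≈ rep a b
    converse = from-yes (∀ᵇ? λ a → ∀ᵇ? λ b → ≈? (rep a b ˘) (rep a b))

    classify : ∀ {R} → Generated (FullRelationAlgebra 3) ∅ R →
               ∃ λ a → ∃ λ b → R ≈ rep a b
    classify (gen ())
    classify (resp p r) with a , b , h ← classify r =
      a , b , λ x y → ≡.trans (≡.sym (p x y)) (h x y)
    classify (g∨ r s) with a , b , h ← classify r | c , d , k ← classify s =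
      a ∨ᵇ c , b ∨ᵇ d , λ x y →
        ≡.trans (≡.cong₂ _∨ᵇ_ (h x y) (k x y)) (pointwise {_∨ᵇ_} a b c d x y)
    classify (g∧ r s) with a , b , h ← classify r | c , d , k ← classify s =
      a ∧ᵇ c , b ∧ᵇ d , λ x y →
        ≡.trans (≡.cong₂ _∧ᵇ_ (h x y) (k x y)) (pointwise {_∧ᵇ_} a b c d x y)
    classify (g· {R} {S} r s) with a , b , h ← classify r | c , d , k ← classify s =
      _ , _ , λ x y → ≡.trans (·-cong {R} {_} {S} h k x y) (compose a b c d x y)
    classify (g′ r) with a , b , h ← classify r =
      not a , not b , λ x y → ≡.trans (≡.cong not (h x y)) (complement a b x y)
    classify (g˘ r) with a , b , h ← classify r =
      a , b , λ x y → ≡.trans (h y x) (converse a b x y)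
    classify g𝟘 = false , false , from-yes (≈? 𝟘 (rep false false))
    classify g𝟙 = true , true , from-yes (≈? 𝟙 (rep true true))
    classify ge = true , false , from-yes (≈? e (rep true false))

    Holds : Term → Term → Bool → Bool → Bool → Bool → Set
    Holds s t a b c d = let v = env (rep a b) (rep c d) (rep c d) in
      eval (FullRelationAlgebra 3) v s ≈ eval (FullRelationAlgebra 3) v t

    Vars₂ : Term → Set
    Vars₂ (var 0)  = ⊤
    Vars₂ (var 1)  = ⊤
    Vars₂ (var (suc (suc _)))  = ⊥
    Vars₂ (s ∨ₜ t) = Vars₂ s × Vars₂ t
    Vars₂ (s ∧ₜ t) = Vars₂ s × Vars₂ t
    Vars₂ (s ·ₜ t) = Vars₂ s × Vars₂ t
    Vars₂ (s ′ₜ)   = Vars₂ s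
    Vars₂ (s ˘ₜ)   = Vars₂ s
    Vars₂ 𝟘ₜ       = ⊤
    Vars₂ 𝟙ₜ       = ⊤
    Vars₂ eₜ       = ⊤

    eval₂ : ∀ A {x y z} v → Algebra._≈_ A (v 0) x → Algebra._≈_ A (v 1) y →
            ∀ t → Vars₂ t → Algebra._≈_ A (eval A v t) (eval A (env x y z) t)
    eval₂ A v p q (var 0) _ = p
    eval₂ A v p q (var 1) _ = q
    eval₂ A v p q (s ∨ₜ t) (a , b) = Algebra.∨-cong A (eval₂ A v p q s a) (eval₂ A v p q t b)
    eval₂ A v p q (s ∧ₜ t) (a , b) = Algebra.∧-cong A (eval₂ A v p q s a) (eval₂ A v p q t b)
    eval₂ A v p q (s ·ₜ t) (a , b) = Algebra.·-cong A (eval₂ A v p q s a) (eval₂ A v p q t b)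
    eval₂ A v p q (s ′ₜ) a = Algebra.′-cong A (eval₂ A v p q s a)
    eval₂ A v p q (s ˘ₜ) a = Algebra.˘-cong A (eval₂ A v p q s a)
    eval₂ A v p q 𝟘ₜ _ = Algebra.≈-refl A
    eval₂ A v p q 𝟙ₜ _ = Algebra.≈-refl A
    eval₂ A v p q eₜ _ = Algebra.≈-refl A

    holds? : ∀ s t → Dec (∀ a b c d → Holds s t a b c d)
    holds? s t = ∀ᵇ? λ a → ∀ᵇ? λ b → ∀ᵇ? λ c → ∀ᵇ? λ d → ≈? _ _

    check : ∀ s t → Vars₂ s → Vars₂ t → (∀ a b c d → Holds s t a b c d) → Id A₃ s t
    check s t vs vt h = Subalgebra-Id (FullRelationAlgebra 3) ∅ {s} {t} λ v g →
      let a , b , p = classify (g 0)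
          c , d , q = classify (g 1)
      in λ x y → ≡.trans (eval₂ (FullRelationAlgebra 3) v p q s vs x y)
           (≡.trans (h a b c d x y)
             (≡.sym (eval₂ (FullRelationAlgebra 3) v p q t vt x y)))

    A₃⊨RSA : A₃ ⊨ RSA-identities
    A₃⊨RSA s t (sa (na p)) =
      Subalgebra-Id (FullRelationAlgebra 3) ∅ {s} {t}
        λ v _ → NA⇒identities (FullRelationAlgebra-NA 3) s t p v
    A₃⊨RSA s t (sa semi) = check s t _ _ (from-yes (holds? s t))
    A₃⊨RSA s t reflex    = check s t _ _ (from-yes (holds? s t))
    A₃⊨RSA s t subadd    = check s t _ _ (from-yes (holds? s t))
    A₃⊨RSA s t symm      = check s t _ _ (from-yes (holds? s t))

A₃-RSA : IsRSA A₃
A₃-RSA = Variety.fromBasis RSA Elements.A₃⊨RSA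

A₃-SA : IsSA A₃
A₃-SA = IsRSA.isSA A₃-RSA

A₃-NA : IsNA A₃
A₃-NA = IsSA.isNA A₃-SA

VarA₃-in-NA : BoundedLattice.Carrier Λ-NA
VarA₃-in-NA = Var A₃ , λ {B} → Var-least A₃ NA A₃-NA {B}

VarA₃-in-SA : BoundedLattice.Carrier Λ-SA
VarA₃-in-SA = Var A₃ , λ {B} → Var-least A₃ SA A₃-SA {B}

VarA₃-in-RSA : BoundedLattice.Carrier Λ-RSA
VarA₃-in-RSA = Var A₃ , λ {B} → Var-least A₃ RSA A₃-RSA {B}

{-# OPTIONS --safe #-}
module Submission where

-- A simple reflexive subadditive symmetric semiassociative relation algebra is the algebra of a
-- reflexive total digraph on its diversity atoms, where p → r iff r ≤ p · p.  For a 0-1 sequence t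
-- take the digraph on the positive integers in which p → r iff r ≤ p - 2, or r = p, or r = p + 1, or
-- r = p - 1 and t r holds, with the finite and cofinite sets.  Two steps along the edges turn
-- every finite nonempty set x into an initial segment, and further steps lengthen it by one atom
-- at a time, so that a whole window of t is readable from every proper x by one term.  For a
-- Toeplitz sequence t coded by S : ℕ → Bool the number of ones in a window of length 3 ^ n is
-- determined up to 1 by S, and for S ≠ T these numbers differ by 2 or more for some n.  Hence
-- the identities "the window has the number of ones prescribed by S" and the same for T
-- together imply that there is no proper x at all, which is an identity ε that defines
-- Var A₃ relative to them.  By Lindenbaum's construction the identities of S extend to a theory maximal among
-- those not containing ε; it defines a join-irreducible cover of Var A₃, and different S give
-- different covers.  As a variety is determined by its countably many identities, the
-- Cantor–Bernstein theorem gives the bijection.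

open import Defs
open import Axiom.ExcludedMiddle using (ExcludedMiddle)
open import Level using (0ℓ; Lift; lift) renaming (suc to lsuc; _⊔_ to _⊔ˡ_)
open import Data.Bool using (Bool; true; false; T; not; if_then_else_)
  renaming (_∧_ to _∧ᵇ_; _∨_ to _∨ᵇ_)
import Data.Bool as Bool
import Data.Bool.Properties as 𝔹
import Data.Fin as Fin
import Data.Fin.Properties as Fin
open import Data.Nat using (ℕ; zero; suc; pred; _+_; _*_; _^_; _⊔_; z≤n; s≤s; _<_)
  renaming (_≤_ to _≤ⁿ_)
import Data.Nat.Properties as ℕ
open import Data.Nat.Solver using (module +-*-Solver)
open import Data.Product using (∃; ∃₂; _×_; _,_; proj₁; proj₂)
open import Data.Sum as Sum using (_⊎_; inj₁; inj₂; [_,_]′)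
open import Data.Empty using (⊥; ⊥-elim)
open import Data.Unit using (tt)
open import Function using (_∘_; id)
open import Function.Bundles using (_⇔_; mk⇔; Equivalence; Bijection)
open import Function.Properties.Equivalence using () renaming (sym to ⇔-sym; trans to ⇔-trans)
open import Relation.Nullary using (¬_; yes; no; does)
open import Relation.Nullary.Decidable using (from-yes)
open import Relation.Unary using (∅)
open import Relation.Binary using (Setoid; _⇒_; tri<; tri≈; tri>)
open import Relation.Binary.Lattice using (BoundedLattice)
import Relation.Binary.Lattice as Order
import Relation.Binary.Reasoning.Setoid as SetoidReasoning
import Relation.Binary.Reasoning.PartialOrder as OrderReasoning
open import Relation.Binary.PropositionalEquality as ≡ using (_≡_; _≢_; refl; _≗_)
import Algebra.Lattice.Bundles as LatB
import Algebra.Lattice.Properties.Lattice as LatticeProps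
import Algebra.Lattice.Properties.BooleanAlgebra as BAProps
import Algebra.Lattice.Structures as Lat

-- The Cantor–Bernstein theorem and an enumeration of the equations

module CantorBernstein {a ℓ₁ b ℓ₂} (em : ExcludedMiddle (a ⊔ˡ b ⊔ˡ ℓ₁))
  (A : Setoid a ℓ₁) (B : Setoid b ℓ₂) where
  private
    module A = Setoid A
    module B = Setoid B

  module _ (f : A.Carrier → B.Carrier)
    (f-cong : ∀ {x y} → x A.≈ y → f x B.≈ f y) (f-inj : ∀ {x y} → f x B.≈ f y → x A.≈ y)
    (g : B.Carrier → A.Carrier)
    (g-cong : ∀ {x y} → x B.≈ y → g x A.≈ g y) (g-inj : ∀ {x y} → g x A.≈ g y → x B.≈ y)
    where

    -- Elements whose history, traced backwards through `g` and `f` in turn, stops outside the image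
    -- of `g`. On them the bijection follows `f`, elsewhere the inverse of `g`.
    data Chain (x : A.Carrier) : Set (a ⊔ˡ b ⊔ˡ ℓ₁) where
      start : ¬ (∃ λ p → g p A.≈ x) → Chain x
      next  : ∀ y → Chain y → g (f y) A.≈ x → Chain x

    Chain-resp : ∀ {x y} → x A.≈ y → Chain x → Chain y
    Chain-resp p (start h)    = start λ (q , r) → h (q , A.trans r (A.sym p))
    Chain-resp p (next y c r) = next y c (A.trans r p)

    -- For a relation, congruence and injectivity are case analyses; excluded middle enters only for
    -- totality and surjectivity.
    data Graph (x : A.Carrier) (p : B.Carrier) : Set (a ⊔ˡ b ⊔ˡ ℓ₁ ⊔ˡ ℓ₂) where
      along : Chain x → f x B.≈ p → Graph x p
      back  : ¬ Chain x → g p A.≈ x → Graph x p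

    image : ∀ x → ∃ (Graph x)
    image x with em {Chain x}
    ... | yes c = f x , along c B.refl
    ... | no ¬c with em {Lift (a ⊔ˡ b ⊔ˡ ℓ₁) (∃ λ p → g p A.≈ x)}
    ...   | yes (lift (p , r)) = p , back ¬c r
    ...   | no h = ⊥-elim (¬c (start (h ∘ lift)))

    functional : ∀ {x y p q} → x A.≈ y → Graph x p → Graph y q → p B.≈ q
    functional r (along _ s) (along _ t) = B.trans (B.sym s) (B.trans (f-cong r) t)
    functional r (along c _) (back h _)  = ⊥-elim (h (Chain-resp r c))
    functional r (back h _)  (along c _) = ⊥-elim (h (Chain-resp (A.sym r) c))
    functional r (back _ s)  (back _ t)  = g-inj (A.trans s (A.trans r (A.sym t)))

    injective : ∀ {x y p q} → p B.≈ q → Graph x p → Graph y q → x A.≈ y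
    injective r (along _ s) (along _ t) = f-inj (B.trans s (B.trans r (B.sym t)))
    injective r (along c s) (back h t)  =
      ⊥-elim (h (next _ c (A.trans (g-cong (B.trans s r)) t)))
    injective r (back h s)  (along c t) =
      ⊥-elim (h (next _ c (A.trans (g-cong (B.trans t (B.sym r))) s)))
    injective r (back _ s)  (back _ t)  = A.trans (A.sym s) (A.trans (g-cong r) t)

    preimage : ∀ p → ∃ λ x → Graph x p
    preimage p with em {Chain (g p)}
    ... | no ¬c              = g p , back ¬c A.refl
    -- `g p` lies in the image of `g`, so its chain cannot start there, and its last step yields the
    -- preimage.
    ... | yes (start h)      = ⊥-elim (h (p , A.refl))
    ... | yes (next y c r)   = y , along c (g-inj r)

    cantorBernstein : Bijection A B
    cantorBernstein = record
      { to        = λ x → proj₁ (image x)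
      ; cong      = λ {x} {y} r → functional r (proj₂ (image x)) (proj₂ (image y))
      ; bijective = (λ {x} {y} r → injective r (proj₂ (image x)) (proj₂ (image y)))
                  , λ p → proj₁ (preimage p) ,
                      λ {z} r → functional r (proj₂ (image z)) (proj₂ (preimage p))
      }

-- Walk along the antidiagonals of ℕ × ℕ.
unpair : ℕ → ℕ × ℕ
unpair zero = 0 , 0
unpair (suc k) with unpair k
... | zero  , n = suc n , 0
... | suc m , n = m , suc n

-- Induction along the walk: `(m , suc n)` comes right after `(suc m , n)`, and `(suc m , 0)` right
-- after `(0 , m)`.
unpair-surjective : ∀ m n → ∃ λ k → unpair k ≡ (m , n)
unpair-surjective m n = diagonal (m + n) m n refl
  where
  diagonal : ∀ d m n → m + n ≡ d → ∃ λ k → unpair k ≡ (m , n)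
  diagonal zero zero zero refl = 0 , refl
  diagonal (suc d) m (suc n) p
    with k , q ← diagonal (suc d) (suc m) n (≡.trans (≡.sym (ℕ.+-suc m n)) p) = suc k , lemma
    where
    lemma : unpair (suc k) ≡ (m , suc n)
    lemma rewrite q = refl
  diagonal (suc d) (suc m) zero p
    with k , q ← diagonal d 0 m (≡.trans (≡.sym (ℕ.+-identityʳ m)) (≡.cong pred p)) =
    suc k , lemma
    where
    lemma : unpair (suc k) ≡ (suc m , 0)
    lemma rewrite q = refl

assemble : ℕ → Term → Term → Term
assemble 0 s t = s
assemble 1 s t = s ∨ₜ t
assemble 2 s t = s ∧ₜ t
assemble 3 s t = s ·ₜ t
assemble 4 s t = s ′ₜ
assemble 5 s t = s ˘ₜ
assemble 6 s t = 𝟘ₜ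
assemble 7 s t = 𝟙ₜ
assemble _ s t = eₜ

-- Tag 0 repeats an earlier term, so a term which occurs at depth d occurs at every greater depth.
termAt : ℕ → ℕ → Term
termAt zero    k = var k
termAt (suc d) k =
  let tag , r = unpair k
      i , j   = unpair r
  in assemble tag (termAt d i) (termAt d j)

data Occurs (d : ℕ) : Term → Set where
  at : ∀ k → Occurs d (termAt d k)

assembled : ∀ d tag {s t} → Occurs d s → Occurs d t → Occurs (suc d) (assemble tag s t)
assembled d tag (at i) (at j)
  with r , p ← unpair-surjective i j
  with k , q ← unpair-surjective tag r = ≡.subst (Occurs (suc d)) lemma (at k)
  where
  lemma : termAt (suc d) k ≡ assemble tag (termAt d i) (termAt d j)
  lemma rewrite q | p = refl

deeper : ∀ c {d t} → Occurs d t → Occurs (c + d) t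
deeper zero    p = p
deeper (suc d) p = assembled _ 0 (deeper d p) (deeper d p)

occurs₁ : ∀ tag {d s} → Occurs d s → ∃ λ d → Occurs d (assemble tag s s)
occurs₁ tag p = _ , assembled _ tag p p

occurs₂ : ∀ tag {d c s t} → Occurs d s → Occurs c t → ∃ λ d → Occurs d (assemble tag s t)
occurs₂ tag {d} {c} {t = t} p q = _ , assembled (c + d) tag (deeper c p)
  (≡.subst (λ n → Occurs n t) (ℕ.+-comm d c) (deeper d q))

occurs : ∀ t → ∃ λ d → Occurs d t
occurs (var i)  = 0 , at i
occurs (s ∨ₜ t) = occurs₂ 1 (proj₂ (occurs s)) (proj₂ (occurs t))
occurs (s ∧ₜ t) = occurs₂ 2 (proj₂ (occurs s)) (proj₂ (occurs t))
occurs (s ·ₜ t) = occurs₂ 3 (proj₂ (occurs s)) (proj₂ (occurs t))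
occurs (s ′ₜ)   = occurs₁ 4 (proj₂ (occurs s))
occurs (s ˘ₜ)   = occurs₁ 5 (proj₂ (occurs s))
-- Constants ignore both arguments, so `var 0` can fill them.
occurs 𝟘ₜ       = occurs₁ 6 {0} (at 0)
occurs 𝟙ₜ       = occurs₁ 7 {0} (at 0)
occurs eₜ       = occurs₁ 8 {0} (at 0)

term : ℕ → Term
term k = let d , i = unpair k in termAt d i

term-surjective : ∀ t → ∃ λ k → term k ≡ t
term-surjective t
  with d , at i ← occurs t
  with k , q ← unpair-surjective d i = k , lemma
  where
  lemma : term k ≡ termAt d i
  lemma rewrite q = refl

equation : ℕ → Term × Term
equation k = let i , j = unpair k in term i , term j

equation-surjective : ∀ s t → ∃ λ k → equation k ≡ (s , t)
equation-surjective s t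
  with i , p ← term-surjective s
  with j , q ← term-surjective t
  with k , r ← unpair-surjective i j = k , lemma
  where
  lemma : equation k ≡ (s , t)
  lemma rewrite r = ≡.cong₂ _,_ p q

-- Maximal theories and covers

Derivable-mono : ∀ {E F} → E ⇒ F → Derivable E ⇒ Derivable F
Derivable-mono i (axiom h σ)  = axiom (i h) σ
Derivable-mono i drefl        = drefl
Derivable-mono i (dsym p)     = dsym (Derivable-mono i p)
Derivable-mono i (dtrans p q) = dtrans (Derivable-mono i p) (Derivable-mono i q)
Derivable-mono i (d∨ p q)     = d∨ (Derivable-mono i p) (Derivable-mono i q)
Derivable-mono i (d∧ p q)     = d∧ (Derivable-mono i p) (Derivable-mono i q)
Derivable-mono i (d· p q)     = d· (Derivable-mono i p) (Derivable-mono i q)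
Derivable-mono i (d′ p)       = d′ (Derivable-mono i p)
Derivable-mono i (d˘ p)       = d˘ (Derivable-mono i p)

derive : ∀ {E : Identities} {s t} → E s t → Derivable E s t
derive {E} {s} {t} h =
  ≡.subst₂ (Derivable E) (subst-var s) (subst-var t) (axiom h var)

module Union (E : ℕ → Identities) (step : ∀ n → E n ⇒ E (suc n)) where

  ⋃ : Identities
  ⋃ s t = ∃ λ n → E n s t

  raise : ∀ m n → E n ⇒ E (m + n)
  raise zero    n h = h
  raise (suc m) n h = step (m + n) (raise m n h)

  raiseˡ : ∀ m n → E m ⇒ E (m + n)
  raiseˡ m n {s} {t} h = ≡.subst (λ k → E k s t) (ℕ.+-comm n m) (raise n m h)


  -- A derivation uses finitely many axioms; at a rule with two premises the sum of their stages
  -- serves both.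
  compact : ∀ {s t} → Derivable ⋃ s t → ∃ λ n → Derivable (E n) s t
  compact (axiom (n , h) σ) = n , axiom h σ
  compact drefl             = 0 , drefl
  compact (dsym p)          = let n , p = compact p in n , dsym p
  compact (dtrans p q)      = let m , p = compact p ; n , q = compact q in
    m + n , dtrans (Derivable-mono (raiseˡ m n) p) (Derivable-mono (raise m n) q)
  compact (d∨ p q)          = let m , p = compact p ; n , q = compact q in
    m + n , d∨ (Derivable-mono (raiseˡ m n) p) (Derivable-mono (raise m n) q)
  compact (d∧ p q)          = let m , p = compact p ; n , q = compact q in
    m + n , d∧ (Derivable-mono (raiseˡ m n) p) (Derivable-mono (raise m n) q)
  compact (d· p q)          = let m , p = compact p ; n , q = compact q in
    m + n , d· (Derivable-mono (raiseˡ m n) p) (Derivable-mono (raise m n) q)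
  compact (d′ p)            = let n , p = compact p in n , d′ p
  compact (d˘ p)            = let n , p = compact p in n , d˘ p

infixl 5 _⊕_
_⊕_ : Identities → Term × Term → Identities
(E ⊕ p) s t = E s t ⊎ (s , t) ≡ p

⊕-mono : ∀ {E F : Identities} {p} → E ⇒ F → E ⊕ p ⇒ F ⊕ p
⊕-mono i = [ inj₁ ∘ i , inj₂ ]′

module Lindenbaum (l r : Term) where

  -- The test for admitting `equation n` is part of the relation, so the stages are defined without
  -- deciding derivability.
  stage : Identities → ℕ → Identities
  stage E zero    = E
  stage E (suc n) s t = stage E n s t ⊎
    ((s , t) ≡ equation n × ¬ Derivable (stage E n ⊕ equation n) l r)

  maximal : Identities → Identities
  maximal E = Union.⋃ (stage E) λ _ → inj₁

  stage-consistent : ∀ {E} → ¬ Derivable E l r → ∀ n → ¬ Derivable (stage E n) l r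
  stage-consistent h zero    d = h d
  stage-consistent {E} h (suc n) d = stage-consistent h n (Derivable-mono unchanged d)
    where
    unchanged : stage E (suc n) ⇒ stage E n
    unchanged (inj₁ p)       = p
    unchanged (inj₂ (_ , k)) =
      ⊥-elim (k (Derivable-mono (λ { (inj₁ p) → inj₁ p ; (inj₂ (p , _)) → inj₂ p }) d))

  maximal-consistent : ∀ {E} → ¬ Derivable E l r → ¬ Derivable (maximal E) l r
  maximal-consistent h d =
    let n , d = Union.compact (stage _) (λ _ → inj₁) d in stage-consistent h n d

  maximal-extends : ∀ {E} → E ⇒ maximal E
  maximal-extends h = 0 , h

  -- An equation outside the theory was rejected at its turn, and the reason for the rejection is
  -- the required derivation.
  maximal-maximal : ExcludedMiddle 0ℓ → ∀ {E s t} → ¬ Derivable (maximal E) s t →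
                    Derivable (maximal E ⊕ (s , t)) l r
  maximal-maximal em {E} {s} {t} h with equation-surjective s t
  ... | n , p with em {Derivable (stage E n ⊕ equation n) l r}
  ...   | yes d = Derivable-mono
    (λ { (inj₁ q) → inj₁ (n , q) ; (inj₂ q) → inj₂ (≡.trans q p) }) d
  ...   | no k  = ⊥-elim (h (derive (suc n , inj₂ (≡.sym p , k))))

  -- Derivability from one stage occurs negatively in the next, so both inclusions are carried
  -- along.
  stage-mono : ∀ {E F} → E ⇒ F → F ⇒ E → ∀ n → stage E n ⇒ stage F n
  stage-mono i j zero    = i
  stage-mono i j (suc n) (inj₁ h) = inj₁ (stage-mono i j n h)
  stage-mono i j (suc n) (inj₂ (p , k)) =
    inj₂ (p , λ d → k (Derivable-mono (⊕-mono (λ {s} {t} → stage-mono j i n {s} {t})) d))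

  maximal-mono : ∀ {E F} → E ⇒ F → F ⇒ E → maximal E ⇒ maximal F
  maximal-mono i j (n , h) = n , stage-mono i j n h

Mod-antitone : ∀ {E F : Identities} → E ⇒ F → Mod F ⊑ Mod E
Mod-antitone i A⊨F _ _ h = A⊨F _ _ (i h)

-- The free algebra of `V` belongs to `W`, and its identities are exactly the consequences of the
-- basis of `V`.
⊑⇒consequence : ∀ V W → V ⊑ W → Derivable (Variety.basis W) ⇒ Derivable (Variety.basis V)
⊑⇒consequence V W V⊑W d = completeness E
  (soundness (Free E) (Variety.toBasis W (V⊑W {Free E} (Variety.fromBasis V (Free⊨ E)))) d)
  where E = Variety.basis V

consequence⇒⊑ : ∀ V W → Variety.basis W ⇒ Derivable (Variety.basis V) → V ⊑ W
consequence⇒⊑ V W i {A} A∈V =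
  Variety.fromBasis W λ s t h → soundness A (Variety.toBasis V A∈V) (i h)

module _ (em : ∀ ℓ → ExcludedMiddle ℓ) where

  -- Since T is maximal among the theories which do not derive l ≈ r, every proper
  -- subvariety of Mod T satisfies l ≈ r and hence lies below V.
  module MaximalCover (W V : Variety) (V⊑W : V ⊑ W) (T : Identities) (l r : Term)
    (T⊑W : Mod T ⊑ W)
    (V⊑T : V ⊑ Mod T)
    (V⊨ : Derivable (Variety.basis V) l r)
    (defines : Mod (T ⊕ (l , r)) ⊑ V)
    (T⊬ : ¬ Derivable T l r)
    (max : ∀ {s t} → ¬ Derivable T s t → Derivable (T ⊕ (s , t)) l r)
    where

    private
      Λ = SubvarietyLattice W
      module Λ = BoundedLattice Λ

    a b : Λ.Carrier
    a = V , λ {A} → V⊑W {A}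
    b = Mod T , λ {A} → T⊑W {A}

    T⋢V : ¬ (Mod T ⊑ V)
    T⋢V h = T⊬ (⊑⇒consequence (Mod T) V h V⊨)

    below : ∀ U → U ⊑ Mod T → ¬ (Mod T ⊑ U) → U ⊑ V
    below U U⊑T h {A} A∈U with em 0ℓ {∃ λ s → ∃ λ t → Variety.basis U s t × ¬ Derivable T s t}
    ... | yes (s , t , u , k) = defines {A} λ
      { _ _ (inj₁ h)    → U⊑T A∈U _ _ h
      ; _ _ (inj₂ refl) → soundness A
          (λ { _ _ (inj₁ h) → U⊑T A∈U _ _ h
             ; _ _ (inj₂ refl) → Variety.toBasis U A∈U _ _ u }) (max k) }
    ... | no k = ⊥-elim (h (consequence⇒⊑ (Mod T) U decide))
      where
      decide : Variety.basis U ⇒ Derivable T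
      decide {s} {t} u with em 0ℓ {Derivable T s t}
      ... | yes d = d
      ... | no ¬d = ⊥-elim (k (s , t , u , ¬d))

    covers : _Covers_ Λ b a
    covers = ((λ {A} → V⊑T {A}) , λ (_ , q) → T⋢V q) ,
      λ ((U , _) , (V⊑U , V≉U) , (U⊑T , U≉T)) →
        V≉U (V⊑U , λ {A} → below U U⊑T (λ T⊑U → U≉T ((λ {A} → U⊑T {A}) , λ {A} → T⊑U {A})) {A})

    -- Proper subvarieties of `Mod T` lie below `V`, hence so does the join of two of them, which
    -- therefore is not `Mod T`.
    joinIrreducible : JoinIrreducible Λ b
    joinIrreducible = (λ (p , _) → T⋢V λ {A} h → Λ.minimum a {A} (p {A} h)) , irreducible
      where
      irreducible : ∀ x y → b Λ.≈ (x Λ.∨ y) → b Λ.≈ x ⊎ b Λ.≈ y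
      irreducible x@(X , _) y@(Y , _) (b≤xy , xy≤b)
        with em (lsuc 0ℓ) {Mod T ⊑ X} | em (lsuc 0ℓ) {Mod T ⊑ Y}
      ... | yes p | _ = inj₁ ((λ {A} → p {A}) , λ {A} h → xy≤b {A} (Λ.x≤x∨y x y {A} h))
      ... | _ | yes p = inj₂ ((λ {A} → p {A}) , λ {A} h → xy≤b {A} (Λ.y≤x∨y x y {A} h))
      ... | no ¬p | no ¬q = ⊥-elim (T⋢V λ {A} h →
        Λ.∨-least {x} {y} {a}
          (λ {A} → below X (λ {A} h → xy≤b {A} (Λ.x≤x∨y x y {A} h)) ¬p {A})
          (λ {A} → below Y (λ {A} h → xy≤b {A} (Λ.y≤x∨y x y {A} h)) ¬q {A}) {A} (b≤xy {A} h))

  module Code (W : Variety) (a : BoundedLattice.Carrier (SubvarietyLattice W)) where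
    S = JoinIrreducibleCovers (SubvarietyLattice W) a
    open Setoid S using (Carrier; _≈_; sym)

    theory : Carrier → Identities
    theory ((V , _) , _) = Derivable (Variety.basis V)

    -- The characteristic function of the equational theory along the enumeration of equations; it
    -- embeds the covers into the 0-1 sequences.
    code : Carrier → ℕ → Bool
    code x n = let s , t = equation n in does (em 0ℓ {theory x s t})

    theory-mono : ∀ {x y} → x ≈ y → theory x ⇒ theory y
    theory-mono {(V , _) , _} {(V′ , _) , _} (_ , q) = ⊑⇒consequence V′ V q

    code-cong : ∀ {x y} → x ≈ y → ∀ n → code x n ≡ code y n
    code-cong {x} {y} x≈y n
      with em 0ℓ {theory x (proj₁ (equation n)) (proj₂ (equation n))}
         | em 0ℓ {theory y (proj₁ (equation n)) (proj₂ (equation n))}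
    ... | yes _ | yes _ = refl
    ... | no _  | no _  = refl
    ... | yes p | no ¬q = ⊥-elim (¬q (theory-mono {x} {y} x≈y p))
    ... | no ¬p | yes q = ⊥-elim (¬p (theory-mono {y} {x} (sym {x} {y} x≈y) q))

    theory-reflect : ∀ {x y} → (∀ n → code x n ≡ code y n) → theory x ⇒ theory y
    theory-reflect {x} {y} h {s} {t} d with n , p ← equation-surjective s t
      with em 0ℓ {theory x (proj₁ (equation n)) (proj₂ (equation n))}
         | em 0ℓ {theory y (proj₁ (equation n)) (proj₂ (equation n))} | h n
    ... | yes _ | yes q | _ = ≡.subst (λ (s , t) → theory y s t) p q
    ... | no ¬p | _     | _ = ⊥-elim (¬p (≡.subst (λ (s , t) → theory x s t) (≡.sym p) d))

    code-injective : ∀ {x y} → (∀ n → code x n ≡ code y n) → x ≈ y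
    code-injective {x@((V , _) , _)} {y@((V′ , _) , _)} h =
      (λ {A} → consequence⇒⊑ V V′ (theory-reflect {y} {x} (≡.sym ∘ h) ∘ derive) {A}) ,
      (λ {A} → consequence⇒⊑ V′ V (theory-reflect {x} {y} h ∘ derive) {A})

-- Boolean and relation algebra

-- The pair (a , b) stands for the join of e, if a, and e ′, if b.
Pairs : Algebra
Pairs = record
  { Carrier = Bool × Bool
  ; _≈_ = _≡_
  ; isEquivalence = ≡.isEquivalence
  ; _∨_ = λ (a , b) (c , d) → a ∨ᵇ c , b ∨ᵇ d
  ; _∧_ = λ (a , b) (c , d) → a ∧ᵇ c , b ∧ᵇ d
  ; _·_ = λ (a , b) (c , d) → (a ∧ᵇ c) ∨ᵇ (b ∧ᵇ d) , (a ∧ᵇ d) ∨ᵇ ((b ∧ᵇ c) ∨ᵇ (b ∧ᵇ d))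
  ; _′  = λ (a , b) → not a , not b
  ; _˘  = id
  ; 𝟘   = false , false
  ; 𝟙   = true , true
  ; e   = true , false
  ; ∨-cong = ≡.cong₂ _ ; ∧-cong = ≡.cong₂ _ ; ·-cong = ≡.cong₂ _
  ; ′-cong = ≡.cong _ ; ˘-cong = id
  }

-- With reflexivity this gives `e ′ · e ′ ≈ 𝟙`, so that the constants multiply as in `Pairs`.
Diverse : Algebra → Set
Diverse C = let open Algebra C in e ′ · 𝟙 ≈ 𝟙

δ : Term
δ = eₜ ′ₜ

-- In a frame algebra this is `𝟙` unless `s` is `𝟘`, so it turns the condition that `s` is nonzero
-- into a term.
closure : Term → Term
closure s = s ·ₜ 𝟙ₜ

-- In a frame algebra this is `𝟙` iff `s` contains none or all of the diversity atoms. For a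
-- variable it gives the identity ε.
integral : Term → Term
integral s = closure (s ∧ₜ δ) ′ₜ ∨ₜ closure (s ′ₜ ∧ₜ δ) ′ₜ

bound : Term → ℕ
bound (var i)  = suc i
bound (s ∨ₜ t) = bound s ⊔ bound t
bound (s ∧ₜ t) = bound s ⊔ bound t
bound (s ·ₜ t) = bound s ⊔ bound t
bound (s ′ₜ)   = bound s
bound (s ˘ₜ)   = bound s
bound 𝟘ₜ       = 0
bound 𝟙ₜ       = 0
bound eₜ       = 0

update : {A : Set} → (ℕ → A) → ℕ → A → ℕ → A
update ρ k p i with i ℕ.≟ k
... | yes _ = p
... | no _  = ρ i

module BooleanReasoning (C : Algebra)
  (isBA : Lat.IsBooleanAlgebra (Algebra._≈_ C) (Algebra._∨_ C) (Algebra._∧_ C) (Algebra._′ C)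
                               (Algebra.𝟙 C) (Algebra.𝟘 C)) where

  open Algebra C hiding (_≤_)

  booleanAlgebra : LatB.BooleanAlgebra 0ℓ 0ℓ
  booleanAlgebra = record { isBooleanAlgebra = isBA }

  open LatB.BooleanAlgebra booleanAlgebra public using
    (∧-comm; ∧-assoc; ∨-assoc; ∧-distribˡ-∨; ∧-distribʳ-∨; ∨-distribˡ-∧
    ; ∨-complementʳ; ∨-complementˡ; ∧-complementʳ; ∧-complementˡ)
  open BAProps booleanAlgebra public using
    (∨-identityʳ; ∨-identityˡ; ∧-identityʳ; ∧-identityˡ; ∧-zeroʳ; ∧-zeroˡ; ∨-zeroʳ; ∨-zeroˡ
    ; ∧-idem; ∨-idem; deMorgan₁; ¬-involutive; ¬⊥≈⊤; ¬⊤≈⊥)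

  -- This order unfolds to `x ≈ x ∧ y`, the mirror image of the one in `Algebra`; hence the uses of
  -- `≈-sym` to pass between them.
  open Order.Lattice
    (LatticeProps.∨-∧-orderTheoreticLattice (LatB.BooleanAlgebra.lattice booleanAlgebra)) public
    using (_≤_; x∧y≤x; x∧y≤y; ∧-greatest; x≤x∨y; y≤x∨y; ∨-least; antisym; poset)
    renaming (refl to ≤-refl; trans to ≤-trans; reflexive to ≤-reflexive)

  ≤-𝟙 : ∀ {x} → x ≤ 𝟙
  ≤-𝟙 = ≈-sym (∧-identityʳ _)

  𝟘-≤ : ∀ {x} → 𝟘 ≤ x
  𝟘-≤ = ≈-sym (∧-zeroˡ _)

  ∧-mono : ∀ {x y z w} → x ≤ y → z ≤ w → x ∧ z ≤ y ∧ w
  ∧-mono p q = ∧-greatest (≤-trans (x∧y≤x _ _) p) (≤-trans (x∧y≤y _ _) q)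

  ≤⇒disjoint : ∀ {x y} → x ≤ y → x ∧ y ′ ≈ 𝟘
  ≤⇒disjoint {x} {y} p = antisym (≤-trans (∧-mono p ≤-refl)
    (≤-reflexive (∧-complementʳ y))) 𝟘-≤

  excluded : ∀ {x z} y → x ∧ y ≤ z → x ∧ y ′ ≤ z → x ≤ z
  excluded {x} {z} y p q = begin
    x                 ≈⟨ ∧-identityʳ x ⟨
    x ∧ 𝟙             ≈⟨ ∧-cong ≈-refl (∨-complementʳ y) ⟨
    x ∧ (y ∨ y ′)     ≈⟨ ∧-distribˡ-∨ x y (y ′) ⟩
    x ∧ y ∨ x ∧ y ′   ≤⟨ ∨-least p q ⟩
    z                 ∎
    where open OrderReasoning poset

  disjoint⇒≤ : ∀ {x y} → x ∧ y ′ ≈ 𝟘 → x ≤ y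
  disjoint⇒≤ {x} {y} p = excluded y (x∧y≤y x y) (≤-trans (≤-reflexive p) 𝟘-≤)

  disjoint⇒≤′ : ∀ {x y} → x ∧ y ≈ 𝟘 → x ≤ y ′
  disjoint⇒≤′ {x} {y} p = disjoint⇒≤ (≈-trans (∧-cong ≈-refl (¬-involutive y)) p)

  resolve : ∀ {p q r} → p ∨ q ≈ 𝟙 → p ∨ r ≈ 𝟙 → q ∧ r ≈ 𝟘 → p ≈ 𝟙
  resolve {p} {q} {r} h k d = begin
    p                   ≈⟨ ∨-identityʳ p ⟨
    p ∨ 𝟘               ≈⟨ ∨-cong ≈-refl d ⟨
    p ∨ q ∧ r           ≈⟨ ∨-distribˡ-∧ p q r ⟩
    (p ∨ q) ∧ (p ∨ r)   ≈⟨ ∧-cong h k ⟩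
    𝟙 ∧ 𝟙               ≈⟨ ∧-idem 𝟙 ⟩
    𝟙                   ∎
    where open SetoidReasoning setoid

-- Ideal elements and the identities of `Pairs`

module RSAProperties (C : Algebra) (isRSA : IsRSA C) where
  open Algebra C hiding (_≤_)
  open IsRSA isRSA using (reflexive; symmetric; isSA)
  open IsSA isSA using (isNA; semiassociative)
  open IsNA isNA using (isBooleanAlgebra; ·-identity; triangle₁; triangle₂)
  open BooleanReasoning C isBooleanAlgebra public
  open Equivalence using (to; from)

  private
    laws : C ⊨ NA-identities
    laws = Variety.toBasis NA isNA

    triple : Carrier → Carrier → Carrier → ℕ → Carrier
    triple x y z 0 = x
    triple x y z 1 = y
    triple x y z (suc (suc _)) = z

  ·-distribˡ-∨ : ∀ x y z → x · (y ∨ z) ≈ x · y ∨ x · z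
  ·-distribˡ-∨ x y z = laws _ _ ·-∨ˡ (triple x y z)

  ·-distribʳ-∨ : ∀ x y z → (y ∨ z) · x ≈ y · x ∨ z · x
  ·-distribʳ-∨ x y z = laws _ _ ·-∨ʳ (triple x y z)

  ·-identityˡ : ∀ x → e · x ≈ x
  ·-identityˡ = proj₁ ·-identity

  ·-identityʳ : ∀ x → x · e ≈ x
  ·-identityʳ = proj₂ ·-identity

  ·-monoʳ : ∀ {x y} z → x ≤ y → z · x ≤ z · y
  ·-monoʳ {x} {y} z p = begin
    z · x              ≤⟨ x≤x∨y _ _ ⟩
    z · x ∨ z · y      ≈⟨ ·-distribˡ-∨ z x y ⟨
    z · (x ∨ y)        ≈⟨ ·-cong ≈-refl (antisym (∨-least p ≤-refl) (y≤x∨y x y)) ⟩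
    z · y              ∎
    where open OrderReasoning poset

  ·-monoˡ : ∀ {x y} z → x ≤ y → x · z ≤ y · z
  ·-monoˡ {x} {y} z p = begin
    x · z              ≤⟨ x≤x∨y _ _ ⟩
    x · z ∨ y · z      ≈⟨ ·-distribʳ-∨ z x y ⟨
    (x ∨ y) · z        ≈⟨ ·-cong (antisym (∨-least p ≤-refl) (y≤x∨y x y)) ≈-refl ⟩
    y · z              ∎
    where open OrderReasoning poset

  -- As converse is trivial, the triangle laws make the condition `x · y ∧ z ≈ 𝟘` invariant under
  -- the two transpositions `rotate` and `reflect`, hence under all permutations.
  rotate : ∀ {x y z} → x · y ∧ z ≈ 𝟘 → x · z ∧ y ≈ 𝟘
  rotate {x} {y} {z} p =
    ≈-trans (∧-cong (·-cong (≈-sym (symmetric x)) ≈-refl) ≈-refl) (to (triangle₁ x y z) p)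

  reflect : ∀ {x y z} → x · y ∧ z ≈ 𝟘 → z · y ∧ x ≈ 𝟘
  reflect {x} {y} {z} p =
    ≈-trans (∧-cong (·-cong ≈-refl (≈-sym (symmetric y))) ≈-refl)
      (to (triangle₂ x y z) (to (triangle₁ x y z) p))

  ·-zeroʳ : ∀ x → x · 𝟘 ≈ 𝟘
  ·-zeroʳ x = antisym
    (≤-trans (≤-reflexive (≈-sym (∧-identityʳ _))) (≤-reflexive (rotate (∧-zeroʳ (x · 𝟙))))) 𝟘-≤

  ·-zeroˡ : ∀ x → 𝟘 · x ≈ 𝟘
  ·-zeroˡ x = antisym
    (≤-trans (≤-reflexive (≈-sym (∧-identityʳ _))) (≤-reflexive (reflect (∧-zeroʳ (𝟙 · x))))) 𝟘-≤

  x≤x·𝟙 : ∀ x → x ≤ x · 𝟙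
  x≤x·𝟙 x = ≤-trans (≤-reflexive (≈-sym (·-identityʳ x))) (·-monoʳ x ≤-𝟙)

  -- The ideal elements. Semiassociativity supplies `x · 𝟙`, the triangle laws supply complements,
  -- and equality below a closed element respects all operations.
  Closed : Carrier → Set
  Closed g = g · 𝟙 ≤ g

  closed-𝟙 : Closed 𝟙
  closed-𝟙 = ≤-𝟙

  closed-·𝟙 : ∀ x → Closed (x · 𝟙)
  closed-·𝟙 x = ≤-reflexive (semiassociative x)

  closed-∧ : ∀ {g h} → Closed g → Closed h → Closed (g ∧ h)
  closed-∧ {g} {h} p q = ∧-greatest
    (≤-trans (·-monoˡ 𝟙 (x∧y≤x g h)) p) (≤-trans (·-monoˡ 𝟙 (x∧y≤y g h)) q)

  closed-′ : ∀ {g} → Closed g → Closed (g ′)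
  closed-′ p = disjoint⇒≤′ (reflect (≤⇒disjoint p))

  closedˡ : ∀ {g} → Closed g → 𝟙 · g ≤ g
  closedˡ {g} p = disjoint⇒≤
    (reflect (rotate (reflect (≤⇒disjoint p))))

  infix 4 _~[_]_
  _~[_]_ : Carrier → Carrier → Carrier → Set
  x ~[ g ] y = x ∧ g ≈ y ∧ g

  ~-antitone : ∀ {x y g h} → h ≤ g → x ~[ g ] y → x ~[ h ] y
  ~-antitone {x} {y} {g} {h} h≤g p = begin
    x ∧ h         ≈⟨ ∧-cong ≈-refl h≈g∧h ⟩
    x ∧ (g ∧ h)   ≈⟨ ∧-assoc x g h ⟨
    (x ∧ g) ∧ h   ≈⟨ ∧-cong p ≈-refl ⟩
    (y ∧ g) ∧ h   ≈⟨ ∧-assoc y g h ⟩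
    y ∧ (g ∧ h)   ≈⟨ ∧-cong ≈-refl h≈g∧h ⟨
    y ∧ h         ∎
    where
    open SetoidReasoning setoid
    h≈g∧h = antisym (∧-greatest h≤g ≤-refl) (x∧y≤y g h)

  ~-patch : ∀ {x y g} h → x ~[ g ∧ h ] y → x ~[ g ∧ h ′ ] y → x ~[ g ] y
  ~-patch {x} {y} {g} h p q = antisym (half p q) (half (≈-sym p) (≈-sym q))
    where
    open OrderReasoning poset
    part : ∀ {x y} k → x ~[ g ∧ k ] y → (x ∧ g) ∧ k ≤ y ∧ g
    part {x} {y} k p = begin
      (x ∧ g) ∧ k   ≈⟨ ∧-assoc x g k ⟩
      x ∧ (g ∧ k)   ≈⟨ p ⟩
      y ∧ (g ∧ k)   ≤⟨ ∧-mono ≤-refl (x∧y≤x g k) ⟩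
      y ∧ g         ∎
    half : ∀ {x y} → x ~[ g ∧ h ] y → x ~[ g ∧ h ′ ] y → x ∧ g ≤ y ∧ g
    half p q = excluded h (part h p) (part (h ′) q)

  ~-∧ : ∀ {g x y z w} → x ~[ g ] y → z ~[ g ] w → x ∧ z ~[ g ] y ∧ w
  ~-∧ p q = antisym (half p q) (half (≈-sym p) (≈-sym q))
    where
    half : ∀ {g x y z w} → x ~[ g ] y → z ~[ g ] w → (x ∧ z) ∧ g ≤ (y ∧ w) ∧ g
    half p q = ∧-greatest
      (∧-greatest (≤-trans (∧-mono (x∧y≤x _ _) ≤-refl) (≤-trans (≤-reflexive p) (x∧y≤x _ _)))
                  (≤-trans (∧-mono (x∧y≤y _ _) ≤-refl) (≤-trans (≤-reflexive q) (x∧y≤x _ _))))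
      (x∧y≤y _ _)

  ~-∨ : ∀ {g x y z w} → x ~[ g ] y → z ~[ g ] w → x ∨ z ~[ g ] y ∨ w
  ~-∨ {g} {x} {y} {z} {w} p q =
    ≈-trans (∧-distribʳ-∨ g x z) (≈-trans (∨-cong p q) (≈-sym (∧-distribʳ-∨ g y w)))

  ~-′ : ∀ {g x y} → x ~[ g ] y → x ′ ~[ g ] y ′
  ~-′ p = antisym (half (≈-sym p)) (half p)
    where
    half : ∀ {g x y} → y ~[ g ] x → x ′ ∧ g ≤ y ′ ∧ g
    half {g} {x} {y} p = ∧-greatest (disjoint⇒≤′ (antisym (begin
      (x ′ ∧ g) ∧ y   ≈⟨ ∧-assoc (x ′) g y ⟩
      x ′ ∧ (g ∧ y)   ≈⟨ ∧-cong ≈-refl (∧-comm g y) ⟩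
      x ′ ∧ (y ∧ g)   ≈⟨ ∧-cong ≈-refl p ⟩
      x ′ ∧ (x ∧ g)   ≤⟨ ∧-mono ≤-refl (x∧y≤x x g) ⟩
      x ′ ∧ x         ≈⟨ ∧-complementˡ x ⟩
      𝟘               ∎) 𝟘-≤)) (x∧y≤y _ _)
      where open OrderReasoning poset

  -- The part of a factor outside a closed element contributes nothing below it.
  ·-localʳ : ∀ {g} → Closed g → ∀ x y → x · y ~[ g ] x · (y ∧ g)
  ·-localʳ {g} c x y = antisym (∧-greatest kept (x∧y≤y _ _))
    (∧-mono (·-monoʳ x (x∧y≤x y g)) ≤-refl)
    where
    open OrderReasoning poset
    kept : (x · y) ∧ g ≤ x · (y ∧ g)
    kept = begin
      (x · y) ∧ g                                 ≤⟨ ∧-mono (·-monoʳ x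
        (excluded g (x≤x∨y (y ∧ g) (y ∧ g ′)) (y≤x∨y (y ∧ g) (y ∧ g ′)))) ≤-refl ⟩
      (x · (y ∧ g ∨ y ∧ g ′)) ∧ g                 ≈⟨ ∧-cong (·-distribˡ-∨ x _ _) ≈-refl ⟩
      (x · (y ∧ g) ∨ x · (y ∧ g ′)) ∧ g           ≈⟨ ∧-distribʳ-∨ g _ _ ⟩
      (x · (y ∧ g)) ∧ g ∨ (x · (y ∧ g ′)) ∧ g     ≤⟨ ∨-least (x∧y≤x _ _) (begin
        (x · (y ∧ g ′)) ∧ g                         ≤⟨ ∧-mono (≤-trans (·-monoˡ _ ≤-𝟙)
          (≤-trans (·-monoʳ 𝟙 (x∧y≤y y (g ′))) (closedˡ (closed-′ c)))) ≤-refl ⟩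
        g ′ ∧ g                                     ≈⟨ ∧-complementˡ g ⟩
        𝟘                                           ≤⟨ 𝟘-≤ ⟩
        x · (y ∧ g)                                 ∎) ⟩
      x · (y ∧ g)                                 ∎

  ·-localˡ : ∀ {g} → Closed g → ∀ x y → x · y ~[ g ] (x ∧ g) · y
  ·-localˡ {g} c x y = antisym (∧-greatest kept (x∧y≤y _ _))
    (∧-mono (·-monoˡ y (x∧y≤x x g)) ≤-refl)
    where
    open OrderReasoning poset
    kept : (x · y) ∧ g ≤ (x ∧ g) · y
    kept = begin
      (x · y) ∧ g                                 ≤⟨ ∧-mono (·-monoˡ y
        (excluded g (x≤x∨y (x ∧ g) (x ∧ g ′)) (y≤x∨y (x ∧ g) (x ∧ g ′)))) ≤-refl ⟩
      ((x ∧ g ∨ x ∧ g ′) · y) ∧ g                 ≈⟨ ∧-cong (·-distribʳ-∨ y _ _) ≈-refl ⟩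
      ((x ∧ g) · y ∨ (x ∧ g ′) · y) ∧ g           ≈⟨ ∧-distribʳ-∨ g _ _ ⟩
      ((x ∧ g) · y) ∧ g ∨ ((x ∧ g ′) · y) ∧ g     ≤⟨ ∨-least (x∧y≤x _ _) (begin
        ((x ∧ g ′) · y) ∧ g                         ≤⟨ ∧-mono (≤-trans (·-monoʳ _ ≤-𝟙)
          (≤-trans (·-monoˡ 𝟙 (x∧y≤y x (g ′))) (closed-′ c))) ≤-refl ⟩
        g ′ ∧ g                                     ≈⟨ ∧-complementˡ g ⟩
        𝟘                                           ≤⟨ 𝟘-≤ ⟩
        (x ∧ g) · y                                 ∎) ⟩
      (x ∧ g) · y                                 ∎

  ~-· : ∀ {g x y z w} → Closed g → x ~[ g ] y → z ~[ g ] w → x · z ~[ g ] y · w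
  ~-· {g} {x} {y} {z} {w} c p q = begin
    x · z ∧ g               ≈⟨ ·-localˡ c x z ⟩
    (x ∧ g) · z ∧ g         ≈⟨ ·-localʳ c (x ∧ g) z ⟩
    (x ∧ g) · (z ∧ g) ∧ g   ≈⟨ ∧-cong (·-cong p q) ≈-refl ⟩
    (y ∧ g) · (w ∧ g) ∧ g   ≈⟨ ·-localʳ c (y ∧ g) w ⟨
    (y ∧ g) · w ∧ g         ≈⟨ ·-localˡ c y w ⟨
    y · w ∧ g               ∎
    where open SetoidReasoning setoid

  ~-eval : ∀ {g v w} → Closed g → ∀ t → (∀ i → i < bound t → v i ~[ g ] w i) →
           eval C v t ~[ g ] eval C w t
  ~-eval {g} {v} {w} c = go
    where
    left : ∀ s t → (∀ i → i < bound s ⊔ bound t → v i ~[ g ] w i) →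
           ∀ i → i < bound s → v i ~[ g ] w i
    left s t h i p = h i (ℕ.≤-trans p (ℕ.m≤m⊔n (bound s) (bound t)))
    right : ∀ s t → (∀ i → i < bound s ⊔ bound t → v i ~[ g ] w i) →
            ∀ i → i < bound t → v i ~[ g ] w i
    right s t h i p = h i (ℕ.≤-trans p (ℕ.m≤n⊔m (bound s) (bound t)))
    go : ∀ t → (∀ i → i < bound t → v i ~[ g ] w i) → eval C v t ~[ g ] eval C w t
    go (var i)  h = h i ℕ.≤-refl
    go (s ∨ₜ t) h = ~-∨ (go s (left s t h)) (go t (right s t h))
    go (s ∧ₜ t) h = ~-∧ (go s (left s t h)) (go t (right s t h))
    go (s ·ₜ t) h = ~-· c (go s (left s t h)) (go t (right s t h))
    go (s ′ₜ)   h = ~-′ (go s h)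
    go (s ˘ₜ)   h = ≈-trans (∧-cong (symmetric _) ≈-refl)
      (≈-trans (go s h) (∧-cong (≈-sym (symmetric _)) ≈-refl))
    go 𝟘ₜ       h = ≈-refl
    go 𝟙ₜ       h = ≈-refl
    go eₜ       h = ≈-refl

  -- Elements below `e` multiply into their meet, so `x · (e ∧ x ′)` is `𝟘`; a triangle law moves
  -- the factor across.
  e-closed : ∀ {x} → x ≤ e → e ∧ x · 𝟙 ≤ x
  e-closed {x} p = disjoint⇒≤ (begin
    (e ∧ x · 𝟙) ∧ x ′   ≈⟨ ∧-cong (∧-comm e _) ≈-refl ⟩
    (x · 𝟙 ∧ e) ∧ x ′   ≈⟨ ∧-assoc (x · 𝟙) e (x ′) ⟩
    x · 𝟙 ∧ e ∧ x ′     ≈⟨ rotate (≈-trans (∧-identityʳ _) (antisym disjoint 𝟘-≤)) ⟩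
    𝟘                   ∎)
    where
    open SetoidReasoning setoid
    disjoint : x · (e ∧ x ′) ≤ 𝟘
    disjoint = ≤-trans (∧-greatest
      (≤-trans (·-monoʳ x (x∧y≤x e (x ′))) (≤-reflexive (·-identityʳ x)))
      (≤-trans (·-monoˡ _ p) (≤-trans (≤-reflexive (·-identityˡ _)) (x∧y≤y e (x ′)))))
      (≤-reflexive (∧-complementʳ x))

  scalar : Bool → Carrier → Carrier
  scalar true  x = x
  scalar false x = 𝟘

  κ : Bool × Bool → Carrier
  κ (true  , true)  = 𝟙
  κ (true  , false) = e
  κ (false , true)  = e ′
  κ (false , false) = 𝟘

  κ≈ : ∀ a b → scalar a e ∨ scalar b (e ′) ≈ κ (a , b)
  κ≈ true  true  = ∨-complementʳ e
  κ≈ true  false = ∨-identityʳ e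
  κ≈ false true  = ∨-identityˡ (e ′)
  κ≈ false false = ∨-identityʳ 𝟘

  module Constants (e′·𝟙 : Diverse C) where

    e′·e′ : e ′ · e ′ ≈ 𝟙
    e′·e′ = antisym ≤-𝟙 (begin
      𝟙                       ≈⟨ e′·𝟙 ⟨
      e ′ · 𝟙                 ≈⟨ ·-cong ≈-refl (∨-complementʳ e) ⟨
      e ′ · (e ∨ e ′)         ≈⟨ ·-distribˡ-∨ (e ′) e (e ′) ⟩
      e ′ · e ∨ e ′ · e ′     ≤⟨ ∨-least (≤-trans (≤-reflexive (·-identityʳ (e ′)))
                                   (≈-sym (reflexive (e ′)))) ≤-refl ⟩
      e ′ · e ′               ∎)
      where open OrderReasoning poset

    𝟙·e′ : 𝟙 · e ′ ≈ 𝟙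
    𝟙·e′ = antisym ≤-𝟙 (≤-trans (≤-reflexive (≈-sym e′·e′)) (·-monoˡ (e ′) ≤-𝟙))

    𝟙·𝟙 : 𝟙 · 𝟙 ≈ 𝟙
    𝟙·𝟙 = antisym ≤-𝟙 (x≤x·𝟙 𝟙)

    private module P = Algebra Pairs

    κ-· : ∀ p q → κ p · κ q ≈ κ (p P.· q)
    κ-· (true  , false) (true  , true)  = ·-identityˡ _
    κ-· (true  , false) (true  , false) = ·-identityˡ _
    κ-· (true  , false) (false , true)  = ·-identityˡ _
    κ-· (true  , false) (false , false) = ·-identityˡ _
    κ-· (false , false) (true  , true)  = ·-zeroˡ _
    κ-· (false , false) (true  , false) = ·-zeroˡ _
    κ-· (false , false) (false , true)  = ·-zeroˡ _
    κ-· (false , false) (false , false) = ·-zeroˡ _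
    κ-· (true  , true)  (true  , true)  = 𝟙·𝟙
    κ-· (true  , true)  (true  , false) = ·-identityʳ _
    κ-· (true  , true)  (false , true)  = 𝟙·e′
    κ-· (true  , true)  (false , false) = ·-zeroʳ _
    κ-· (false , true)  (true  , true)  = e′·𝟙
    κ-· (false , true)  (true  , false) = ·-identityʳ _
    κ-· (false , true)  (false , true)  = e′·e′
    κ-· (false , true)  (false , false) = ·-zeroʳ _

    κ-∨ : ∀ p q → κ p ∨ κ q ≈ κ (p P.∨ q)
    κ-∨ (true  , true)  (_ , _)         = ∨-zeroˡ _
    κ-∨ (false , false) (true  , true)  = ∨-identityˡ _
    κ-∨ (false , false) (true  , false) = ∨-identityˡ _
    κ-∨ (false , false) (false , true)  = ∨-identityˡ _
    κ-∨ (false , false) (false , false) = ∨-identityˡ _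
    κ-∨ (true  , false) (true  , true)  = ∨-zeroʳ _
    κ-∨ (true  , false) (true  , false) = ∨-idem _
    κ-∨ (true  , false) (false , true)  = ∨-complementʳ _
    κ-∨ (true  , false) (false , false) = ∨-identityʳ _
    κ-∨ (false , true)  (true  , true)  = ∨-zeroʳ _
    κ-∨ (false , true)  (true  , false) = ∨-complementˡ _
    κ-∨ (false , true)  (false , true)  = ∨-idem _
    κ-∨ (false , true)  (false , false) = ∨-identityʳ _

    κ-∧ : ∀ p q → κ p ∧ κ q ≈ κ (p P.∧ q)
    κ-∧ (false , false) (_ , _)         = ∧-zeroˡ _
    κ-∧ (true  , true)  (true  , true)  = ∧-identityˡ _
    κ-∧ (true  , true)  (true  , false) = ∧-identityˡ _
    κ-∧ (true  , true)  (false , true)  = ∧-identityˡ _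
    κ-∧ (true  , true)  (false , false) = ∧-identityˡ _
    κ-∧ (true  , false) (true  , true)  = ∧-identityʳ _
    κ-∧ (true  , false) (true  , false) = ∧-idem _
    κ-∧ (true  , false) (false , true)  = ∧-complementʳ _
    κ-∧ (true  , false) (false , false) = ∧-zeroʳ _
    κ-∧ (false , true)  (true  , true)  = ∧-identityʳ _
    κ-∧ (false , true)  (true  , false) = ∧-complementˡ _
    κ-∧ (false , true)  (false , true)  = ∧-idem _
    κ-∧ (false , true)  (false , false) = ∧-zeroʳ _

    κ-′ : ∀ p → κ p ′ ≈ κ (p P.′)
    κ-′ (true  , true)  = ¬⊤≈⊥
    κ-′ (true  , false) = ≈-refl
    κ-′ (false , true)  = ¬-involutive e
    κ-′ (false , false) = ¬⊥≈⊤

    κ-eval : ∀ ρ t → eval C (κ ∘ ρ) t ≈ κ (eval Pairs ρ t)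
    κ-eval ρ (var i)  = ≈-refl
    κ-eval ρ (s ∨ₜ t) = ≈-trans (∨-cong (κ-eval ρ s) (κ-eval ρ t)) (κ-∨ (eval Pairs ρ s) (eval Pairs ρ t))
    κ-eval ρ (s ∧ₜ t) = ≈-trans (∧-cong (κ-eval ρ s) (κ-eval ρ t)) (κ-∧ (eval Pairs ρ s) (eval Pairs ρ t))
    κ-eval ρ (s ·ₜ t) = ≈-trans (·-cong (κ-eval ρ s) (κ-eval ρ t)) (κ-· (eval Pairs ρ s) (eval Pairs ρ t))
    κ-eval ρ (s ′ₜ)   = ≈-trans (′-cong (κ-eval ρ s)) (κ-′ (eval Pairs ρ s))
    κ-eval ρ (s ˘ₜ)   = ≈-trans (symmetric _) (κ-eval ρ s)
    κ-eval ρ 𝟘ₜ       = ≈-refl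
    κ-eval ρ 𝟙ₜ       = ≈-refl
    κ-eval ρ eₜ       = ≈-refl

    e≈𝟘⇒ : e ≈ 𝟘 → 𝟙 ≈ 𝟘
    e≈𝟘⇒ p = ≈-trans (≈-sym (·-identityˡ 𝟙)) (≈-trans (·-cong p ≈-refl) (·-zeroˡ 𝟙))

    e′≈𝟘⇒ : e ′ ≈ 𝟘 → 𝟙 ≈ 𝟘
    e′≈𝟘⇒ p = ≈-trans (≈-sym e′·𝟙) (≈-trans (·-cong p ≈-refl) (·-zeroˡ 𝟙))

    κ-injective : ¬ 𝟙 ≈ 𝟘 → ∀ p q → κ p ≈ κ q → p ≡ q
    κ-injective 𝟙≉𝟘 (a , b) (c , d) r =
      ≡.cong₂ _,_ (compare (𝟙≉𝟘 ∘ e≈𝟘⇒) a c (onE a b c d r))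
                  (compare (𝟙≉𝟘 ∘ e′≈𝟘⇒) b d (onE′ a b c d r))
      where
      compare : ∀ {x} → ¬ x ≈ 𝟘 → ∀ a c → scalar a x ≈ scalar c x → a ≡ c
      compare h true  true  p = refl
      compare h true  false p = ⊥-elim (h p)
      compare h false true  p = ⊥-elim (h (≈-sym p))
      compare h false false p = refl
      κ∧e : ∀ a b → κ (a , b) ∧ e ≈ scalar a e
      κ∧e true  true  = ∧-identityˡ e
      κ∧e true  false = ∧-idem e
      κ∧e false true  = ∧-complementˡ e
      κ∧e false false = ∧-zeroˡ e
      κ∧e′ : ∀ a b → κ (a , b) ∧ e ′ ≈ scalar b (e ′)
      κ∧e′ true  true  = ∧-identityˡ (e ′)
      κ∧e′ true  false = ∧-complementʳ e
      κ∧e′ false true  = ∧-idem (e ′)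
      κ∧e′ false false = ∧-zeroˡ (e ′)
      onE : ∀ a b c d → κ (a , b) ≈ κ (c , d) → scalar a e ≈ scalar c e
      onE a b c d r = ≈-trans (≈-sym (κ∧e a b)) (≈-trans (∧-cong r ≈-refl) (κ∧e c d))
      onE′ : ∀ a b c d → κ (a , b) ≈ κ (c , d) → scalar b (e ′) ≈ scalar d (e ′)
      onE′ a b c d r = ≈-trans (≈-sym (κ∧e′ a b)) (≈-trans (∧-cong r ≈-refl) (κ∧e′ c d))

    -- In the nontrivial case `κ` embeds `Pairs`.
    Id⇒Id-Pairs : ¬ 𝟙 ≈ 𝟘 → ∀ {s t} → Id C s t → Id Pairs s t
    Id⇒Id-Pairs 𝟙≉𝟘 {s} {t} h ρ = κ-injective 𝟙≉𝟘 _ _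
      (≈-trans (≈-sym (κ-eval ρ s)) (≈-trans (h (κ ∘ ρ)) (κ-eval ρ t)))

    module _ {s t} (valid : Id Pairs s t) where

      κ-valued : ∀ {g} → Closed g → ∀ {v} ρ → (∀ i → i < bound s ⊔ bound t → v i ~[ g ] κ (ρ i)) →
                 eval C v s ~[ g ] eval C v t
      κ-valued {g} c {v} ρ h = begin
        eval C v s ∧ g             ≈⟨ ~-eval c s (λ i p → h i (ℕ.≤-trans p (ℕ.m≤m⊔n _ _))) ⟩
        eval C (κ ∘ ρ) s ∧ g       ≈⟨ ∧-cong (κ-eval ρ s) ≈-refl ⟩
        κ (eval Pairs ρ s) ∧ g     ≡⟨ ≡.cong (λ p → κ p ∧ g) (valid ρ) ⟩
        κ (eval Pairs ρ t) ∧ g     ≈⟨ ∧-cong (κ-eval ρ t) ≈-refl ⟨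
        eval C (κ ∘ ρ) t ∧ g       ≈⟨ ~-eval c t (λ i p → h i (ℕ.≤-trans p (ℕ.m≤n⊔m (bound s) _))) ⟨
        eval C v t ∧ g             ∎
        where open SetoidReasoning setoid

      module _ (int : Id C (integral (var 0)) 𝟙ₜ) where

        -- By De Morgan, integrality makes `(x ∧ e ′) · 𝟙` and `(x ′ ∧ e ′) · 𝟙` disjoint, and the
        -- part of `e ′` outside `x` lies below the second.
        e′-closed : ∀ {x} → x ≤ e ′ → e ′ ∧ x · 𝟙 ≤ x
        e′-closed {x} p = disjoint⇒≤ (antisym (begin
          (e ′ ∧ x · 𝟙) ∧ x ′                     ≤⟨ ∧-greatest
            (≤-trans (x∧y≤x _ _) (x∧y≤y _ _))
            (≤-trans (∧-greatest (x∧y≤y _ _) (≤-trans (x∧y≤x _ _) (x∧y≤x _ _))) (x≤x·𝟙 _)) ⟩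
          x · 𝟙 ∧ (x ′ ∧ e ′) · 𝟙                 ≈⟨ ∧-cong (·-cong p ≈-refl) ≈-refl ⟩
          (x ∧ e ′) · 𝟙 ∧ (x ′ ∧ e ′) · 𝟙         ≈⟨ ¬-involutive _ ⟨
          (((x ∧ e ′) · 𝟙 ∧ (x ′ ∧ e ′) · 𝟙) ′) ′ ≈⟨ ′-cong (≈-trans (deMorgan₁ _ _) (int (λ _ → x))) ⟩
          𝟙 ′                                     ≈⟨ ¬⊤≈⊥ ⟩
          𝟘                                       ∎) 𝟘-≤)
          where open OrderReasoning poset

        -- Below (x ∧ d) · 𝟙 and below its complement, x ∧ d agrees with d and with 𝟘.
        module Halves (d : Carrier) (d-closed : ∀ {x} → x ≤ d → d ∧ x · 𝟙 ≤ x) (x : Carrier) where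

          support : Carrier
          support = (x ∧ d) · 𝟙

          piece : Bool → Carrier
          piece true  = support
          piece false = support ′

          closed-piece : ∀ a → Closed (piece a)
          closed-piece true  = closed-·𝟙 _
          closed-piece false = closed-′ (closed-·𝟙 _)

          agrees : ∀ a → x ∧ d ~[ piece a ] scalar a d
          agrees true  = antisym (∧-mono (x∧y≤y x d) ≤-refl)
            (∧-greatest (d-closed (x∧y≤y x d)) (x∧y≤y _ _))
          agrees false = antisym
            (≤-trans (≤-trans (∧-mono (x≤x·𝟙 _) ≤-refl) (≤-reflexive (∧-complementʳ _))) 𝟘-≤)
            (≤-trans (x∧y≤x _ _) 𝟘-≤)

        module _ {L R : Carrier} where

          -- The supports of `x` on `e` and on `e ′` cut `g` into four closed pieces, on each of
          -- which `x` agrees with a constant.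
          by-cases : ∀ {g} → Closed g → ∀ x →
            (∀ h → Closed h → h ≤ g → ∀ p → x ~[ h ] κ p → L ~[ h ] R) → L ~[ g ] R
          by-cases {g} c x k =
            ~-patch (E.piece true)
              (~-patch (D.piece true) (case true true) (case true false))
              (~-patch (D.piece true) (case false true) (case false false))
            where
            module E = Halves e e-closed x
            module D = Halves (e ′) e′-closed x
            x≈ : x ≈ x ∧ e ∨ x ∧ e ′
            x≈ = antisym (excluded e (x≤x∨y _ _) (y≤x∨y _ _)) (∨-least (x∧y≤x _ _) (x∧y≤x _ _))
            case : ∀ a b → L ~[ (g ∧ E.piece a) ∧ D.piece b ] R
            case a b = k _ (closed-∧ (closed-∧ c (E.closed-piece a)) (D.closed-piece b))
              (≤-trans (x∧y≤x _ _) (x∧y≤x _ _)) (a , b)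
              (≈-trans (∧-cong x≈ ≈-refl) (≈-trans
                (~-∨ (~-antitone (≤-trans (x∧y≤x _ _) (x∧y≤y _ _)) (E.agrees a))
                     (~-antitone (x∧y≤y _ _) (D.agrees b)))
                (∧-cong (κ≈ a b) ≈-refl)))

        -- Variables from `k` on already agree with constants below `g`. Shrinking `g` makes them
        -- constant one at a time, downwards, until all values lie in the image of `Pairs`.
        localise : ∀ k {g} → Closed g → ∀ {v} ρ →
          (∀ i → k ≤ⁿ i → i < bound s ⊔ bound t → v i ~[ g ] κ (ρ i)) →
          eval C v s ~[ g ] eval C v t
        localise zero    c ρ h = κ-valued c ρ (λ i → h i z≤n)
        localise (suc k) c {v} ρ h = by-cases c (v k) λ g′ c′ g′≤g p r →
          localise k c′ (update ρ k p) (extend g′≤g p r)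
          where
          extend : ∀ {g′} → g′ ≤ _ → ∀ p → v k ~[ g′ ] κ p → ∀ i → k ≤ⁿ i →
                   i < bound s ⊔ bound t → v i ~[ g′ ] κ (update ρ k p i)
          extend g′≤g p r i k≤i i<n with i ℕ.≟ k
          ... | yes refl = r
          ... | no i≢k   = ~-antitone g′≤g (h i (ℕ.≤∧≢⇒< k≤i (i≢k ∘ ≡.sym)) i<n)

        Id-Pairs⇒Id : Id C s t
        Id-Pairs⇒Id v = ≈-trans (≈-sym (∧-identityʳ _)) (≈-trans
          (localise (bound s ⊔ bound t) closed-𝟙 (λ _ → true , true)
            (λ i n≤i i<n → ⊥-elim (ℕ.<-irrefl refl (ℕ.<-≤-trans i<n n≤i))))
          (∧-identityʳ _))

-- The identities attached to a 0-1 sequence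

-- The fixed zero in each block of three makes `density` a base 3 expansion with digits 0 and 1
-- only; this keeps different sequences at distance 2 or more.
weave : Bool → (ℕ → Bool) → ℕ → Bool
weave b u 0 = b
weave b u 1 = false
weave b u 2 = u 0
weave b u (suc (suc (suc n))) = weave b (u ∘ suc) n

-- The first N layers of the Toeplitz sequence which repeats S 0 with period 3,
-- S 1 with period 9, S 2 with period 27, and so on.
toeplitz : ℕ → (ℕ → Bool) → ℕ → Bool
toeplitz zero    S = λ _ → false
toeplitz (suc N) S = weave (S 0) (toeplitz N (S ∘ suc))

-- Every window of length 3 ^ n contains density n S or 1 + density n S ones.
density : ℕ → (ℕ → Bool) → ℕ
density zero    S = 0
density (suc n) S = (if S 0 then 3 ^ n else 0) + density n (S ∘ suc)

density-cong : ∀ n {S T} → S ≗ T → density n S ≡ density n T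
density-cong zero    h = refl
density-cong (suc n) h = ≡.cong₂ (λ b k → (if b then 3 ^ n else 0) + k) (h 0) (density-cong n (h ∘ suc))

-- A gap of 2 keeps the possible counts m, m + 1 and n, n + 1 disjoint.
Apart : ℕ → ℕ → Set
Apart m n = 2 + m ≤ⁿ n ⊎ 2 + n ≤ⁿ m

apart-+ : ∀ k {m n} → Apart m n → Apart (k + m) (k + n)
apart-+ k {m} {n} (inj₁ p) = inj₁ (≡.subst (_≤ⁿ k + n)
  (≡.trans (ℕ.+-suc k (suc m)) (≡.cong suc (ℕ.+-suc k m))) (ℕ.+-monoʳ-≤ k p))
apart-+ k {m} {n} (inj₂ p) = inj₂ (≡.subst (_≤ⁿ k + m)
  (≡.trans (ℕ.+-suc k (suc n)) (≡.cong suc (ℕ.+-suc k n))) (ℕ.+-monoʳ-≤ k p))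

differ : ∀ {b c j k} → b ≤ⁿ 1 → c ≤ⁿ 1 → Apart j k → b + j ≢ c + k
differ {b} {c} {j} {k} p q (inj₁ r) h = ℕ.<-irrefl h
  (ℕ.≤-trans (s≤s (ℕ.+-monoˡ-≤ j p)) (ℕ.≤-trans r (ℕ.m≤n+m k c)))
differ {b} {c} {j} {k} p q (inj₂ r) h = ℕ.<-irrefl (≡.sym h)
  (ℕ.≤-trans (s≤s (ℕ.+-monoˡ-≤ k q)) (ℕ.≤-trans r (ℕ.m≤n+m j b)))

densities-apart : ∀ S T i → S i ≢ T i → ∃ λ n → Apart (density n S) (density n T)
densities-apart S T i S≢T with S 0 Bool.≟ T 0
-- One digit would give a difference of 1 only; with two digits it is at least 3 - 1.
... | no S₀≢T₀ = 2 , leading S₀≢T₀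
  where
  leading : S 0 ≢ T 0 → Apart (density 2 S) (density 2 T)
  leading h with S 0 | T 0 | S 1 | T 1
  ... | true  | true  | _     | _     = ⊥-elim (h refl)
  ... | false | false | _     | _     = ⊥-elim (h refl)
  ... | true  | false | true  | true  = inj₂ (s≤s (s≤s (s≤s z≤n)))
  ... | true  | false | true  | false = inj₂ (s≤s (s≤s z≤n))
  ... | true  | false | false | true  = inj₂ (s≤s (s≤s (s≤s z≤n)))
  ... | true  | false | false | false = inj₂ (s≤s (s≤s z≤n))
  ... | false | true  | true  | true  = inj₁ (s≤s (s≤s (s≤s z≤n)))
  ... | false | true  | true  | false = inj₁ (s≤s (s≤s (s≤s z≤n)))
  ... | false | true  | false | true  = inj₁ (s≤s (s≤s z≤n))
  ... | false | true  | false | false = inj₁ (s≤s (s≤s z≤n))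
densities-apart S T zero    S≢T | yes p = ⊥-elim (S≢T p)
densities-apart S T (suc i) S≢T | yes p
  with n , a ← densities-apart (S ∘ suc) (T ∘ suc) i S≢T = suc n ,
  ≡.subst (λ b → Apart (density (suc n) S) ((if b then 3 ^ n else 0) + density n (T ∘ suc))) p
    (apart-+ (if S 0 then 3 ^ n else 0) a)

-- In the algebra of a digraph, ◇ s is the set of successors of s, if s lies below e ′.
◇ : Term → Term
◇ s = (s ·ₜ s) ∧ₜ δ

-- A proper initial segment of e ′ if s ∧ e ′ is finite and nonempty, and e ′ if it is cofinite.
hull : Term → Term
hull s = ◇ (◇ (s ∧ₜ δ))

cohull : Term → Term
cohull s = δ ∧ₜ hull s ′ₜ

segment : Term → ℕ → Term
segment s zero    = hull s
segment s (suc i) = ◇ (segment s i)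

increment : Term → ℕ → Term
increment s i = segment s (suc i) ∧ₜ segment s i ′ₜ

-- If the increments i and i + 1 are the atoms p and p + 1, the digit is different from 𝟘
-- iff there is an edge from p + 1 to p.
digit : Term → ℕ → Term
digit s i = (increment s (suc i) ·ₜ increment s i) ∧ₜ increment s (suc i)

-- A count by case distinction on the last digit, where `closure` serves as a truth value. The meet
-- with `𝟘ₜ` gives both clauses the shape that `branch-disjoint` handles.
exactly : Term → ℕ → ℕ → Term
exactly s zero    zero    = 𝟙ₜ
exactly s zero    (suc k) = 𝟘ₜ
exactly s (suc n) zero    =
  closure (digit s n) ∧ₜ 𝟘ₜ ∨ₜ closure (digit s n) ′ₜ ∧ₜ exactly s n zero
exactly s (suc n) (suc k) =
  closure (digit s n) ∧ₜ exactly s n k ∨ₜ closure (digit s n) ′ₜ ∧ₜ exactly s n (suc k)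

-- In a frame algebra: `s` contains no diversity atom or almost all of them, and there is no window
-- to read.
improper : Term → Term
improper s = closure (s ∧ₜ δ) ′ₜ ∨ₜ closure (cohull s) ′ₜ

almost : Term → ℕ → ℕ → Term
almost s n k = exactly s n k ∨ₜ exactly s n (suc k)

-- In a frame algebra `proper` says that if `x` splits `e ′`, then `x` or its complement is not
-- improper. `N` bounds the windows, so that `toeplitz N S` gives a model.
data Axioms (S : ℕ → Bool) (N : ℕ) : Identities where
  rsa     : ∀ {s t} → RSA-identities s t → Axioms S N s t
  diverse : Axioms S N (closure δ) 𝟙ₜ
  proper  : Axioms S N (integral (var 0) ∨ₜ (closure (cohull (var 0)) ∨ₜ closure (cohull (var 0 ′ₜ)))) 𝟙ₜ
  window  : ∀ n → n ≤ⁿ N →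
            Axioms S N (improper (var 0) ∨ₜ almost (var 0) (3 ^ n) (density n S)) 𝟙ₜ

Axioms-suc : ∀ S N → Axioms S N ⇒ Axioms S (suc N)
Axioms-suc S N (rsa h)      = rsa h
Axioms-suc S N diverse      = diverse
Axioms-suc S N proper       = proper
Axioms-suc S N (window n p) = window n (ℕ.m≤n⇒m≤1+n p)

Axioms-cong : ∀ {S T} → S ≗ T → ∀ {N} → Axioms S N ⇒ Axioms T N
Axioms-cong h (rsa k)      = rsa k
Axioms-cong h diverse      = diverse
Axioms-cong h proper       = proper
Axioms-cong {S} {T} h {N} (window n p) =
  ≡.subst (λ d → Axioms T N (improper (var 0) ∨ₜ almost (var 0) (3 ^ n) d) 𝟙ₜ)
    (≡.sym (density-cong n h)) (window n p)

Base : (ℕ → Bool) → Identities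
Base S s t = ∃ λ N → Axioms S N s t

Base-RSA : ∀ {S} C → C ⊨ Base S → IsRSA C
Base-RSA C h = Variety.fromBasis RSA λ s t p → h s t (0 , rsa p)

-- Incompatibility of different densities

module Incompatible (C : Algebra) (isRSA : IsRSA C) where
  open Algebra C hiding (_≤_)
  open RSAProperties C isRSA

  branch-true : ∀ c {p q} → (c ∧ p ∨ c ′ ∧ q) ∧ c ≤ p
  branch-true c {p} {q} = begin
    (c ∧ p ∨ c ′ ∧ q) ∧ c           ≈⟨ ∧-distribʳ-∨ c (c ∧ p) (c ′ ∧ q) ⟩
    (c ∧ p) ∧ c ∨ (c ′ ∧ q) ∧ c     ≤⟨ ∨-least (≤-trans (x∧y≤x _ _) (x∧y≤y _ _)) (begin
      (c ′ ∧ q) ∧ c                   ≤⟨ ∧-mono (x∧y≤x (c ′) q) ≤-refl ⟩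
      c ′ ∧ c                         ≈⟨ ∧-complementˡ c ⟩
      𝟘                               ≤⟨ 𝟘-≤ ⟩
      p                               ∎) ⟩
    p                               ∎
    where open OrderReasoning poset

  branch-false : ∀ c {p q} → (c ∧ p ∨ c ′ ∧ q) ∧ c ′ ≤ q
  branch-false c {p} {q} = begin
    (c ∧ p ∨ c ′ ∧ q) ∧ c ′             ≈⟨ ∧-distribʳ-∨ (c ′) (c ∧ p) (c ′ ∧ q) ⟩
    (c ∧ p) ∧ c ′ ∨ (c ′ ∧ q) ∧ c ′     ≤⟨ ∨-least (begin
      (c ∧ p) ∧ c ′                       ≤⟨ ∧-mono (x∧y≤x c p) ≤-refl ⟩
      c ∧ c ′                             ≈⟨ ∧-complementʳ c ⟩
      𝟘                                   ≤⟨ 𝟘-≤ ⟩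
      q                                   ∎) (≤-trans (x∧y≤x _ _) (x∧y≤y _ _)) ⟩
    q                                   ∎
    where open OrderReasoning poset

  branch-disjoint : ∀ c {p q r s} → p ∧ r ≈ 𝟘 → q ∧ s ≈ 𝟘 →
                    (c ∧ p ∨ c ′ ∧ q) ∧ (c ∧ r ∨ c ′ ∧ s) ≈ 𝟘
  branch-disjoint c h k = antisym (excluded c
    (≤-trans (∧-greatest (≤-trans (∧-mono (x∧y≤x _ _) ≤-refl) (branch-true c))
                         (≤-trans (∧-mono (x∧y≤y _ _) ≤-refl) (branch-true c))) (≤-reflexive h))
    (≤-trans (∧-greatest (≤-trans (∧-mono (x∧y≤x _ _) ≤-refl) (branch-false c))
                         (≤-trans (∧-mono (x∧y≤y _ _) ≤-refl) (branch-false c))) (≤-reflexive k)))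
    𝟘-≤

  module _ (v : ℕ → Carrier) (s : Term) where

    exactly-disjoint : ∀ n j k → j ≢ k →
      eval C v (exactly s n j) ∧ eval C v (exactly s n k) ≈ 𝟘
    exactly-disjoint zero    zero    zero    j≢k = ⊥-elim (j≢k refl)
    exactly-disjoint zero    zero    (suc k) j≢k = ∧-zeroʳ _
    exactly-disjoint zero    (suc j) k       j≢k = ∧-zeroˡ _
    exactly-disjoint (suc n) zero    zero    j≢k = ⊥-elim (j≢k refl)
    exactly-disjoint (suc n) zero    (suc k) j≢k =
      branch-disjoint _ (∧-zeroˡ _) (exactly-disjoint n zero (suc k) j≢k)
    exactly-disjoint (suc n) (suc j) zero    j≢k =
      branch-disjoint _ (∧-zeroʳ _) (exactly-disjoint n (suc j) zero j≢k)
    exactly-disjoint (suc n) (suc j) (suc k) j≢k =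
      branch-disjoint _ (exactly-disjoint n j k (j≢k ∘ ≡.cong suc))
        (exactly-disjoint n (suc j) (suc k) j≢k)

    almost-disjoint : ∀ n {j k} → Apart j k →
      eval C v (almost s n j) ∧ eval C v (almost s n k) ≈ 𝟘
    almost-disjoint n {j} {k} a = antisym (≤-trans
      (≤-reflexive (≈-trans (∧-distribʳ-∨ _ _ _) (∨-cong (∧-distribˡ-∨ _ _ _) (∧-distribˡ-∨ _ _ _))))
      (∨-least (∨-least (disjoint j k (differ z≤n z≤n a)) (disjoint j (suc k) (differ z≤n (s≤s z≤n) a)))
               (∨-least (disjoint (suc j) k (differ (s≤s z≤n) z≤n a)) (disjoint (suc j) (suc k) (differ (s≤s z≤n) (s≤s z≤n) a)))))
      𝟘-≤
      where
      disjoint : ∀ i l → i ≢ l → eval C v (exactly s n i) ∧ eval C v (exactly s n l) ≤ 𝟘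
      disjoint i l h = ≤-reflexive (exactly-disjoint n i l h)

  -- The two window terms are disjoint, so `improper` is `𝟙` at every element. At `x` and at `x ′`
  -- this cancels the two `cohull` terms of `proper`, and what remains lies below `integral`.
  incompatible : ∀ {S T} → C ⊨ Base S → C ⊨ Base T → ∀ n → Apart (density n S) (density n T) →
                 Id C (integral (var 0)) 𝟙ₜ
  incompatible {S} {T} hS hT n a v =
    resolve (resolve (≈-trans (∨-assoc _ _ _) (hS _ _ (0 , proper) v))
               (top (∨-least (≤-trans (y≤x∨y _ _) (≤-trans (x≤x∨y _ _) (x≤x∨y _ _))) (y≤x∨y _ _)) (bad v′))
               (∧-complementʳ _))
      (top (∨-least (≤-trans (x≤x∨y _ _) (x≤x∨y _ _)) (y≤x∨y _ _)) (bad v)) (∧-complementʳ _)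
    where
    v′ : ℕ → Carrier
    v′ i = v i ′

    top : ∀ {x y} → x ≤ y → x ≈ 𝟙 → y ≈ 𝟙
    top x≤y p = antisym ≤-𝟙 (≤-trans (≤-reflexive (≈-sym p)) x≤y)

    bad : ∀ v → eval C v (improper (var 0)) ≈ 𝟙
    bad v = resolve (hS _ _ (n , window n ℕ.≤-refl) v) (hT _ _ (n , window n ℕ.≤-refl) v)
      (almost-disjoint v (var 0) (3 ^ n) a)

-- The identities of `A₃`

module Minimal (A : Algebra) (isRSA : IsRSA (MinimalSubalgebra A))
  (diverse : Diverse (MinimalSubalgebra A)) where
  private module P = Algebra Pairs
  open Algebra (MinimalSubalgebra A)
  open RSAProperties (MinimalSubalgebra A) isRSA using (κ; closed-𝟙; module Constants; ∧-identityʳ)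
  open Constants diverse

  -- The values of `κ` are closed under all operations, so they exhaust a subalgebra generated by
  -- the empty set.
  represent : ∀ {x} (g : Generated A ∅ x) → ∃ λ p → (x , g) ≈ κ p
  represent (gen ())
  represent (resp q g) with p , h ← represent g =
    p , Algebra.≈-trans A (Algebra.≈-sym A q) h
  represent (g∨ {x} {y} f g) with p , h ← represent f | q , k ← represent g =
    p P.∨ q , ≈-trans {(x , f) ∨ (y , g)} {κ p ∨ κ q} {κ (p P.∨ q)}
      (∨-cong {x , f} {κ p} {y , g} {κ q} h k) (κ-∨ p q)
  represent (g∧ {x} {y} f g) with p , h ← represent f | q , k ← represent g =
    p P.∧ q , ≈-trans {(x , f) ∧ (y , g)} {κ p ∧ κ q} {κ (p P.∧ q)}
      (∧-cong {x , f} {κ p} {y , g} {κ q} h k) (κ-∧ p q)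
  represent (g· {x} {y} f g) with p , h ← represent f | q , k ← represent g =
    p P.· q , ≈-trans {(x , f) · (y , g)} {κ p · κ q} {κ (p P.· q)}
      (·-cong {x , f} {κ p} {y , g} {κ q} h k) (κ-· p q)
  represent (g′ {x} f) with p , h ← represent f =
    p P.′ , ≈-trans {(x , f) ′} {κ p ′} {κ (p P.′)} (′-cong {x , f} {κ p} h) (κ-′ p)
  represent (g˘ {x} f) with p , h ← represent f =
    p , ≈-trans {(x , f) ˘} {x , f} {κ p} (IsRSA.symmetric isRSA (x , f)) h
  represent g𝟘 = (false , false) , Algebra.≈-refl A
  represent g𝟙 = (true , true) , Algebra.≈-refl A
  represent ge = (true , false) , Algebra.≈-refl A

  Id-Pairs⇒Id-Minimal : ∀ {s t} → Id Pairs s t → Id (MinimalSubalgebra A) s t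
  Id-Pairs⇒Id-Minimal {s} {t} h v = ≈-trans {x} {x ∧ 𝟙} {y}
    (≈-sym {x ∧ 𝟙} {x} (∧-identityʳ x))
    (≈-trans {x ∧ 𝟙} {y ∧ 𝟙} {y} (κ-valued {s} {t} h {𝟙} closed-𝟙 {v} ρ agrees) (∧-identityʳ y))
    where
    x y : Carrier
    x = eval (MinimalSubalgebra A) v s
    y = eval (MinimalSubalgebra A) v t
    ρ : ℕ → Bool × Bool
    ρ i = proj₁ (represent (proj₂ (v i)))
    agrees : ∀ i → _ → v i ∧ 𝟙 ≈ κ (ρ i) ∧ 𝟙
    agrees i _ = ∧-cong {v i} {κ (ρ i)} {𝟙} {𝟙} (proj₂ (represent (proj₂ (v i)))) (≈-refl {𝟙})

  Id-Minimal⇒Id-Pairs : ¬ 𝟙 ≈ 𝟘 → ∀ {s t} → Id (MinimalSubalgebra A) s t → Id Pairs s t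
  Id-Minimal⇒Id-Pairs 𝟙≉𝟘 {s} {t} = Id⇒Id-Pairs 𝟙≉𝟘 {s} {t}

A₃-diverse : Diverse A₃
A₃-diverse = from-yes (Fin.all? λ x → Fin.all? λ y →
  let open Algebra (FullRelationAlgebra 3) in (e ′ · 𝟙) x y Bool.≟ true)

A₃-nontrivial : let open Algebra A₃ in ¬ 𝟙 ≈ 𝟘
A₃-nontrivial p with () ← p Fin.zero Fin.zero

module A₃-Pairs = Minimal (FullRelationAlgebra 3) A₃-RSA A₃-diverse

Id-Pairs⇒Id-A₃ : ∀ {s t} → Id Pairs s t → Id A₃ s t
Id-Pairs⇒Id-A₃ {s} {t} = A₃-Pairs.Id-Pairs⇒Id-Minimal {s} {t}

Id-A₃⇒Id-Pairs : ∀ {s t} → Id A₃ s t → Id Pairs s t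
Id-A₃⇒Id-Pairs {s} {t} = A₃-Pairs.Id-Minimal⇒Id-Pairs A₃-nontrivial {s} {t}

integral-A₃ : Id A₃ (integral (var 0)) 𝟙ₜ
integral-A₃ = Id-Pairs⇒Id-A₃ {integral (var 0)} {𝟙ₜ} λ ρ → valid (ρ 0)
  where
  valid : ∀ p → eval Pairs (λ _ → p) (integral (var 0)) ≡ (true , true)
  valid (true  , true)  = refl
  valid (true  , false) = refl
  valid (false , true)  = refl
  valid (false , false) = refl

module _ (C : Algebra) (isRSA : IsRSA C) (diverse : Diverse C) where
  open Algebra C
  open RSAProperties C isRSA
  open Constants diverse

  integral⇒VarA₃ : Id C (integral (var 0)) 𝟙ₜ → Member (Var A₃) C
  integral⇒VarA₃ int s t h = Id-Pairs⇒Id {s} {t} (Id-A₃⇒Id-Pairs {s} {t} h) int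

  -- This places `A₃` in the variety generated by `C`; applied to free algebras, it puts `Var A₃`
  -- below the covers.
  A₃-generic : ¬ 𝟙 ≈ 𝟘 → ∀ {s t} → Id C s t → Id A₃ s t
  A₃-generic 𝟙≉𝟘 {s} {t} h = Id-Pairs⇒Id-A₃ {s} {t} (Id⇒Id-Pairs 𝟙≉𝟘 {s} {t} h)

  trivial⇒integral : 𝟙 ≈ 𝟘 → Id C (integral (var 0)) 𝟙ₜ
  trivial⇒integral p v = antisym ≤-𝟙 (≤-trans (≤-reflexive p) 𝟘-≤)

-- The algebra of a frame

T-antisym : ∀ {a b} → (T a → T b) → (T b → T a) → a ≡ b
T-antisym {true}  {true}  f g = refl
T-antisym {true}  {false} f g with () ← f tt
T-antisym {false} {true}  f g with () ← g tt
T-antisym {false} {false} f g = refl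

T⇒true : ∀ {a} → T a → a ≡ true
T⇒true {true} _ = refl

T-pair : ∀ {a b} → T a → T b → T (a ∧ᵇ b)
T-pair {true} {true} _ _ = tt

T-unpair : ∀ {a b} → T (a ∧ᵇ b) → T a × T b
T-unpair {true} {true} _ = tt , tt

T-either : ∀ {a b} → T a ⊎ T b → T (a ∨ᵇ b)
T-either {true}          _ = tt
T-either {false} {true}  _ = tt
T-either {false} {false} (inj₁ ())
T-either {false} {false} (inj₂ ())

T-or : ∀ {a b} → T (a ∨ᵇ b) → T a ⊎ T b
T-or {true}  p = inj₁ tt
T-or {false} p = inj₂ p

T-not : ∀ {a} → ¬ T a → T (not a)
T-not {true}  h = h tt
T-not {false} h = tt

T-not⁻ : ∀ {a} → T (not a) → ¬ T a
T-not⁻ {false} _ ()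

module Frame (em : ExcludedMiddle 0ℓ) (t : ℕ → Bool) where

  decided : Set → Bool
  decided P = does (em {P})

  decided⁺ : ∀ {P} → P → T (decided P)
  decided⁺ {P} p with em {P}
  ... | yes _ = tt
  ... | no ¬p = ¬p p

  decided⁻ : ∀ {P} → T (decided P) → P
  decided⁻ {P} h with em {P}
  ... | yes p = p

  -- The atom 0 is the identity, and p ↦ r means that r lies below p · p.
  infix 4 _↦_
  data _↦_ : ℕ → ℕ → Set where
    unit : ∀ {p} → p ↦ 0
    loop : ∀ {p} → p ↦ p
    -- The step up begins at the atom 1, since the identity atom has no successor but itself.
    up   : ∀ {p} → suc p ↦ suc (suc p)
    down : ∀ {p r} → suc (suc r) ≤ⁿ p → p ↦ r
    back : ∀ {r} → T (t r) → suc r ↦ r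

  ↦-total : ∀ p r → p ↦ r ⊎ r ↦ p
  ↦-total zero    r       = inj₂ unit
  ↦-total (suc p) zero    = inj₁ unit
  ↦-total (suc p) (suc r) with ℕ.<-cmp p r
  ... | tri≈ _ refl _ = inj₁ loop
  ... | tri< p<r _ _ with ℕ.m≤n⇒m<n∨m≡n p<r
  ...   | inj₁ h    = inj₂ (down (s≤s h))
  ...   | inj₂ refl = inj₁ up
  ↦-total (suc p) (suc r) | tri> _ _ r<p with ℕ.m≤n⇒m<n∨m≡n r<p
  ...   | inj₁ h    = inj₁ (down (s≤s h))
  ...   | inj₂ refl = inj₂ up

  ↦-bound : ∀ {p r} → p ↦ r → r ≤ⁿ suc p
  ↦-bound unit     = z≤n
  ↦-bound loop     = ℕ.n≤1+n _
  ↦-bound up       = ℕ.≤-refl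
  ↦-bound (down h) = ℕ.≤-trans (ℕ.≤-trans (ℕ.n≤1+n _) (ℕ.≤-trans (ℕ.n≤1+n _) h)) (ℕ.n≤1+n _)
  ↦-bound (back _) = ℕ.≤-trans (ℕ.n≤1+n _) (ℕ.n≤1+n _)

  0↦ : ∀ {r} → 0 ↦ r → r ≡ 0
  0↦ unit      = refl
  0↦ loop      = refl
  0↦ (down ())

  back⁻ : ∀ {r} → suc (suc r) ↦ suc r → T (t (suc r))
  back⁻ (down h) = ⊥-elim (ℕ.<-irrefl refl h)
  back⁻ (back h) = h

  -- The atomic triples with r below p · q: two entries coincide, with an edge from the repeated
  -- atom to the third. The permutation symmetry yields the triangle laws.
  data Cycle (p q r : ℕ) : Set where
    ppr : p ≡ q → p ↦ r → Cycle p q r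
    pqp : p ≡ r → p ↦ q → Cycle p q r
    pqq : q ≡ r → q ↦ p → Cycle p q r

  swap : ∀ {p q r} → Cycle p q r → Cycle q p r
  swap (ppr refl h) = ppr refl h
  swap (pqp refl h) = pqq refl h
  swap (pqq refl h) = pqp refl h

  rotate : ∀ {p q r} → Cycle p q r → Cycle p r q
  rotate (ppr refl h) = pqp refl h
  rotate (pqp refl h) = ppr refl h
  rotate (pqq refl h) = pqq refl h

  -- Hence `x · 𝟙` is full for nonempty `x`, which gives semiassociativity.
  total : ∀ p r → ∃ λ q → Cycle p q r
  total p r with ↦-total p r
  ... | inj₁ h = p , ppr refl h
  ... | inj₂ h = r , pqq refl h

  Cycle-bound : ∀ {p q r} → Cycle p q r → r ≤ⁿ suc p ⊎ r ≤ⁿ suc q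
  Cycle-bound (ppr refl h) = inj₁ (↦-bound h)
  Cycle-bound (pqp refl h) = inj₁ (ℕ.n≤1+n _)
  Cycle-bound (pqq refl h) = inj₂ (ℕ.n≤1+n _)

  Cycle-0 : ∀ {q r} → Cycle 0 q r → q ≡ r
  Cycle-0 (ppr refl h) = ≡.sym (0↦ h)
  Cycle-0 (pqp refl h) = 0↦ h
  Cycle-0 (pqq refl h) = refl

  -- The finite sets, with final value `false`, and the cofinite ones, with `true`.
  EventuallyConstant : (ℕ → Bool) → Set
  EventuallyConstant f = ∃ λ b → ∃ λ N → ∀ n → N ≤ⁿ n → f n ≡ b

  Subset : Set
  Subset = ∃ EventuallyConstant

  infix 4 _∈_
  _∈_ : ℕ → Subset → Set
  n ∈ x = T (proj₁ x n)

  pointwise : (_⊙_ : Bool → Bool → Bool) → Subset → Subset → Subset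
  pointwise _⊙_ (f , b , N , h) (g , c , M , k) = (λ n → f n ⊙ g n) , b ⊙ c , N ⊔ M ,
    λ n p → ≡.cong₂ _⊙_ (h n (ℕ.≤-trans (ℕ.m≤m⊔n N M) p)) (k n (ℕ.≤-trans (ℕ.m≤n⊔m N M) p))

  Product : Subset → Subset → ℕ → Set
  Product x y r = ∃₂ λ p q → p ∈ x × q ∈ y × Cycle p q r

  product-swap : ∀ {x y r} → Product x y r → Product y x r
  product-swap (p , q , i , j , c) = q , p , j , i , swap c

  product : Subset → Subset → ℕ → Bool
  product x y r = decided (Product x y r)

  product-comm : ∀ x y r → product x y r ≡ product y x r
  product-comm x y r = T-antisym
    (decided⁺ ∘ product-swap {x} {y} ∘ decided⁻) (decided⁺ ∘ product-swap {y} {x} ∘ decided⁻)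

  product-cofinite : ∀ x y → proj₁ (proj₂ x) ≡ true → EventuallyConstant (product x y)
  product-cofinite x@(f , .true , N , h) y refl with em {∃ (_∈ y)}
  -- From `2 + q` on every atom has an edge down to `q`, so those in `x` recur in the product.
  ... | yes (q , j) = true , N ⊔ (2 + q) , λ n p → T⇒true (decided⁺
    (n , q , ≡.subst T (≡.sym (h n (ℕ.≤-trans (ℕ.m≤m⊔n N (2 + q)) p))) tt , j ,
     pqp refl (down (ℕ.≤-trans (ℕ.m≤n⊔m N (2 + q)) p))))
  ... | no k = false , 0 , λ n _ → T-antisym (λ i → let _ , q , _ , j , _ = decided⁻ i in k (q , j)) λ ()

  product-constant : ∀ x y → EventuallyConstant (product x y)
  product-constant x@(f , true , N , h) y = product-cofinite x y refl
  product-constant x y@(f , true , N , h) =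
    let b , M , k = product-cofinite y x refl in b , M , λ n p → ≡.trans (product-comm x y n) (k n p)
  -- Two finite factors: a cycle reaches at most one atom beyond the larger of them.
  product-constant x@(f , false , N , h) y@(g , false , M , k) = false , suc (N + M) ,
    λ n N+M<n → T-antisym (λ i → far n N+M<n (decided⁻ i)) λ ()
    where
    far : ∀ n → suc (N + M) ≤ⁿ n → Product x y n → ⊥
    far n N+M<n (p , q , i , j , c) with ℕ.<-≤-connex p N | ℕ.<-≤-connex q M
    ... | inj₂ N≤p | _ = ≡.subst T (h p N≤p) i
    ... | _ | inj₂ M≤q = ≡.subst T (k q M≤q) j
    ... | inj₁ p<N | inj₁ q<M with Cycle-bound c
    ...   | inj₁ r = ℕ.<-irrefl refl (ℕ.≤-trans N+M<n (ℕ.≤-trans r (ℕ.≤-trans p<N (ℕ.m≤m+n N M))))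
    ...   | inj₂ r = ℕ.<-irrefl refl (ℕ.≤-trans N+M<n (ℕ.≤-trans r (ℕ.≤-trans q<M (ℕ.m≤n+m M N))))

  isZero : ℕ → Bool
  isZero zero    = true
  isZero (suc _) = false

  algebra : Algebra
  algebra = record
    { Carrier = Subset
    ; _≈_ = λ (f , _) (g , _) → ∀ n → f n ≡ g n
    ; isEquivalence = record
      { refl = λ _ → refl ; sym = λ p n → ≡.sym (p n) ; trans = λ p q n → ≡.trans (p n) (q n) }
    ; _∨_ = pointwise _∨ᵇ_
    ; _∧_ = pointwise _∧ᵇ_
    ; _·_ = λ x y → product x y , product-constant x y
    ; _′  = λ (f , b , N , h) → not ∘ f , not b , N , λ n p → ≡.cong not (h n p)
    ; _˘  = id
    ; 𝟘   = (λ _ → false) , false , 0 , λ _ _ → refl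
    ; 𝟙   = (λ _ → true) , true , 0 , λ _ _ → refl
    ; e   = isZero , false , 1 , λ { (suc n) _ → refl }
    ; ∨-cong = λ p q n → ≡.cong₂ _∨ᵇ_ (p n) (q n)
    ; ∧-cong = λ p q n → ≡.cong₂ _∧ᵇ_ (p n) (q n)
    ; ·-cong = λ {x} {y} {u} {v} p q r → T-antisym
        (decided⁺ ∘ transport {x} {y} {u} {v} p q ∘ decided⁻)
        (decided⁺ ∘ transport {y} {x} {v} {u} (λ n → ≡.sym (p n)) (λ n → ≡.sym (q n)) ∘ decided⁻)
    ; ′-cong = λ p n → ≡.cong not (p n)
    ; ˘-cong = id
    }
    where
    transport : ∀ {x y u v : Subset} → (∀ n → proj₁ x n ≡ proj₁ y n) → (∀ n → proj₁ u n ≡ proj₁ v n) →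
                ∀ {r} → Product x u r → Product y v r
    transport f g (p , q , i , j , c) = p , q , ≡.subst T (f p) i , ≡.subst T (g q) j , c

  open Algebra algebra

  _⊆_ : Subset → Subset → Set
  x ⊆ y = ∀ n → n ∈ x → n ∈ y

  ⊆-antisym : ∀ {x y} → x ⊆ y → y ⊆ x → x ≈ y
  ⊆-antisym p q n = T-antisym (p n) (q n)

  full : ∀ {x} → (∀ n → n ∈ x) → x ≈ 𝟙
  full h n = T⇒true (h n)

  private module B = Lat.IsBooleanAlgebra 𝔹.∨-∧-isBooleanAlgebra

  isBooleanAlgebra : Lat.IsBooleanAlgebra _≈_ _∨_ _∧_ _′ 𝟙 𝟘
  isBooleanAlgebra = record
    { isDistributiveLattice = record
      { isLattice = record
        { isEquivalence = isEquivalence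
        ; ∨-comm     = λ x y n → B.∨-comm (proj₁ x n) (proj₁ y n)
        ; ∨-assoc    = λ x y z n → B.∨-assoc (proj₁ x n) (proj₁ y n) (proj₁ z n)
        ; ∨-cong     = λ {x} {y} {u} {v} → ∨-cong {x} {y} {u} {v}
        ; ∧-comm     = λ x y n → B.∧-comm (proj₁ x n) (proj₁ y n)
        ; ∧-assoc    = λ x y z n → B.∧-assoc (proj₁ x n) (proj₁ y n) (proj₁ z n)
        ; ∧-cong     = λ {x} {y} {u} {v} → ∧-cong {x} {y} {u} {v}
        ; absorptive = (λ x y n → B.∨-absorbs-∧ (proj₁ x n) (proj₁ y n))
                     , (λ x y n → B.∧-absorbs-∨ (proj₁ x n) (proj₁ y n))
        }
      ; ∨-distrib-∧ = (λ x y z n → B.∨-distribˡ-∧ (proj₁ x n) (proj₁ y n) (proj₁ z n))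
                    , (λ x y z n → B.∨-distribʳ-∧ (proj₁ x n) (proj₁ y n) (proj₁ z n))
      ; ∧-distrib-∨ = (λ x y z n → B.∧-distribˡ-∨ (proj₁ x n) (proj₁ y n) (proj₁ z n))
                    , (λ x y z n → B.∧-distribʳ-∨ (proj₁ x n) (proj₁ y n) (proj₁ z n))
      }
    ; ∨-complement = (λ x n → B.∨-complementˡ (proj₁ x n)) , (λ x n → B.∨-complementʳ (proj₁ x n))
    ; ∧-complement = (λ x n → B.∧-complementˡ (proj₁ x n)) , (λ x n → B.∧-complementʳ (proj₁ x n))
    ; ¬-cong       = λ {x} {y} → ′-cong {x} {y}
    }

  ∈-·⁺ : ∀ {x y p q r} → p ∈ x → q ∈ y → Cycle p q r → r ∈ x · y
  ∈-·⁺ i j c = decided⁺ (_ , _ , i , j , c)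

  ∈-·⁻ : ∀ {x y r} → r ∈ x · y → Product x y r
  ∈-·⁻ = decided⁻

  CycleFree : Subset → Subset → Subset → Set
  CycleFree x y z = ∀ p q r → p ∈ x → q ∈ y → r ∈ z → Cycle p q r → ⊥

  disjoint⇔ : ∀ x y z → (x · y ∧ z ≈ 𝟘) ⇔ CycleFree x y z
  disjoint⇔ x y z = mk⇔
    (λ h p q r i j k c → ≡.subst T (h r) (T-pair (∈-·⁺ {x} {y} i j c) k))
    (λ h r → T-antisym (λ m → let m , k = T-unpair m
                                  p , q , i , j , c = ∈-·⁻ {x} {y} m in h p q r i j k c) λ ())

  isNA : IsNA algebra
  isNA = record
    { isBooleanAlgebra = isBooleanAlgebra
    ; ·-identity = identityˡ , λ x n → ≡.trans (product-comm x e n) (identityˡ x n)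
    ; triangle₁  = λ x y z → ⇔-trans (disjoint⇔ x y z) (⇔-trans
        (mk⇔ (λ h p q r i j k c → h p r q i k j (rotate c)) (λ h p q r i j k c → h p r q i k j (rotate c)))
        (⇔-sym (disjoint⇔ x z y)))
    ; triangle₂  = λ x y z → ⇔-trans (disjoint⇔ x z y) (⇔-trans
        (mk⇔ (λ h p q r i j k c → h r p q k i j (swap (rotate c)))
             (λ h p q r i j k c → h q r p j k i (rotate (swap c))))
        (⇔-sym (disjoint⇔ z y x)))
    }
    where
    identityˡ : ∀ x → e · x ≈ x
    identityˡ x = ⊆-antisym {e · x} {x}
      (λ n m → case (∈-·⁻ {e} {x} m)) (λ n i → ∈-·⁺ {e} {x} {0} tt i (pqq refl unit))
      where
      case : ∀ {n} → Product e x n → n ∈ x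
      case (zero , q , _ , j , c) = ≡.subst (_∈ x) (Cycle-0 c) j

  ·𝟙-full : ∀ x {p} → p ∈ x → ∀ r → r ∈ x · 𝟙
  ·𝟙-full x {p} i r = ∈-·⁺ {x} {𝟙} i tt (proj₂ (total p r))

  isRSA : IsRSA algebra
  isRSA = record
    { isSA = record
      { isNA = isNA
      ; semiassociative = λ x → ⊆-antisym {(x · 𝟙) · 𝟙} {x · 𝟙}
          (λ n m → let _ , _ , i , _ = ∈-·⁻ {x · 𝟙} {𝟙} m
                       _ , _ , j , _ = ∈-·⁻ {x} {𝟙} i in ·𝟙-full x j n)
          (λ n m → ·𝟙-full (x · 𝟙) m n)
      }
    ; reflexive = λ x → ⊆-antisym {x ∧ x · x} {x} (λ n m → proj₁ (T-unpair m))
        (λ n m → T-pair m (∈-·⁺ {x} {x} m m (ppr refl loop)))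
    ; subadditive = λ x y → ⊆-antisym {x · (x ′ ∧ y) ∧ (x ∨ y)} {x · (x ′ ∧ y)}
        (λ n m → proj₁ (T-unpair m)) (λ n m → T-pair m (T-either (bounded x y (∈-·⁻ {x} {x ′ ∧ y} m))))
    ; symmetric = λ x n → refl
    }
    where
    bounded : ∀ x y {n} → Product x (x ′ ∧ y) n → n ∈ x ⊎ n ∈ y
    -- The factors are disjoint, so the repeated atom of the cycle includes the product's atom.
    bounded x y (p , q , i , j , ppr refl _) = ⊥-elim (T-not⁻ (proj₁ (T-unpair j)) i)
    bounded x y (p , q , i , j , pqp refl _) = inj₁ i
    bounded x y (p , q , i , j , pqq refl _) = inj₂ (proj₂ (T-unpair j))

  ·𝟙≈𝟙 : ∀ x {p} → p ∈ x → x · 𝟙 ≈ 𝟙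
  ·𝟙≈𝟙 x i = full {x · 𝟙} (·𝟙-full x i)

  ·𝟙′≈𝟙 : ∀ x → (∀ n → ¬ n ∈ x) → (x · 𝟙) ′ ≈ 𝟙
  ·𝟙′≈𝟙 x h = full {(x · 𝟙) ′} λ n → T-not λ m → let _ , _ , i , _ = ∈-·⁻ {x} {𝟙} m in h _ i

-- Windows of Toeplitz sequences and the frames they define

bit : Bool → ℕ
bit b = if b then 1 else 0

ones : (ℕ → Bool) → ℕ → ℕ
ones f zero    = 0
ones f (suc n) = bit (f n) + ones f n

ones-cong : ∀ {f g} → (∀ i → f i ≡ g i) → ∀ n → ones f n ≡ ones g n
ones-cong h zero    = refl
ones-cong h (suc n) = ≡.cong₂ (λ b k → bit b + k) (h n) (ones-cong h n)

ones-cons : ∀ f n → ones f (suc n) ≡ bit (f 0) + ones (f ∘ suc) n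
ones-cons f zero    = refl
ones-cons f (suc n) = ≡.trans (≡.cong (bit (f (suc n)) +_) (ones-cons f n))
  (solve 3 (λ a b c → a :+ (b :+ c) := b :+ (a :+ c)) refl
    (bit (f (suc n))) (bit (f 0)) (ones (f ∘ suc) n))
  where open +-*-Solver

ones-cons₃ : ∀ f n → ones f (3 + n) ≡ bit (f 0) + (bit (f 1) + (bit (f 2) + ones (f ∘ (3 +_)) n))
ones-cons₃ f n = ≡.trans (ones-cons f (2 + n)) (≡.cong (bit (f 0) +_)
  (≡.trans (ones-cons (f ∘ suc) (1 + n)) (≡.cong (bit (f 1) +_) (ones-cons (f ∘ (2 +_)) n))))

private
  multiple : Bool → ℕ → ℕ
  multiple b L = if b then L else 0

  multiple-zero : ∀ b → multiple b 0 ≡ 0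
  multiple-zero true  = refl
  multiple-zero false = refl

  multiple-suc : ∀ b L → multiple b (suc L) ≡ bit b + multiple b L
  multiple-suc true  L = refl
  multiple-suc false L = refl

-- Every window of length 3L, wherever it starts, meets each residue class L times: it has L copies
-- of `b`, L zeros and L consecutive entries of `u`.
weave-window : ∀ q L b u → ∃ λ r →
  ones (λ i → weave b u (q + i)) (L * 3) ≡ (if b then L else 0) + ones (λ i → u (r + i)) L
weave-window (suc (suc (suc q))) L b u =
  let r , p = weave-window q L b (u ∘ suc) in suc r , p
weave-window 0 L b u = 0 , go L u
  where
  open +-*-Solver
  go : ∀ L u → ones (weave b u) (L * 3) ≡ multiple b L + ones u L
  go zero    u = ≡.sym (≡.cong (_+ 0) (multiple-zero b))
  go (suc L) u = ≡.trans (ones-cons₃ (weave b u) (L * 3))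
    (≡.trans (≡.cong (λ k → bit b + (0 + (bit (u 0) + k))) (go L (u ∘ suc)))
    (≡.trans (solve 4 (λ a c m k → a :+ (c :+ (m :+ k)) := (a :+ m) :+ (c :+ k)) refl
        (bit b) (bit (u 0)) (multiple b L) (ones (u ∘ suc) L))
      (≡.cong₂ _+_ (≡.sym (multiple-suc b L)) (≡.sym (ones-cons u L)))))
weave-window 1 L b u = 0 , go L u
  where
  open +-*-Solver
  go : ∀ L u → ones (λ i → weave b u (1 + i)) (L * 3) ≡ multiple b L + ones u L
  go zero    u = ≡.sym (≡.cong (_+ 0) (multiple-zero b))
  go (suc L) u = ≡.trans (ones-cons₃ (λ i → weave b u (1 + i)) (L * 3))
    (≡.trans (≡.cong (λ k → 0 + (bit (u 0) + (bit b + k))) (go L (u ∘ suc)))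
    (≡.trans (solve 4 (λ a c m k → c :+ (a :+ (m :+ k)) := (a :+ m) :+ (c :+ k)) refl
        (bit b) (bit (u 0)) (multiple b L) (ones (u ∘ suc) L))
      (≡.cong₂ _+_ (≡.sym (multiple-suc b L)) (≡.sym (ones-cons u L)))))
weave-window 2 L b u = 0 , go L u
  where
  open +-*-Solver
  go : ∀ L u → ones (λ i → weave b u (2 + i)) (L * 3) ≡ multiple b L + ones u L
  go zero    u = ≡.sym (≡.cong (_+ 0) (multiple-zero b))
  go (suc L) u = ≡.trans (ones-cons₃ (λ i → weave b u (2 + i)) (L * 3))
    (≡.trans (≡.cong (λ k → bit (u 0) + (bit b + (0 + k))) (go L (u ∘ suc)))
    (≡.trans (solve 4 (λ a c m k → c :+ (a :+ (m :+ k)) := (a :+ m) :+ (c :+ k)) refl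
        (bit b) (bit (u 0)) (multiple b L) (ones (u ∘ suc) L))
      (≡.cong₂ _+_ (≡.sym (multiple-suc b L)) (≡.sym (ones-cons u L)))))

-- Each layer contributes a fixed number; the only uncertainty is the single entry left after `n`
-- layers.
toeplitz-window : ∀ n {N} → n ≤ⁿ N → ∀ S q →
  let k = ones (λ i → toeplitz N S (q + i)) (3 ^ n) in
  k ≡ density n S ⊎ k ≡ suc (density n S)
toeplitz-window zero {N} _ S q with toeplitz N S (q + 0)
... | true  = inj₂ refl
... | false = inj₁ refl
toeplitz-window (suc n) (s≤s {n = N} p) S q
  with r , h ← weave-window q (3 ^ n) (S 0) (toeplitz N (S ∘ suc))
  rewrite ℕ.*-comm 3 (3 ^ n) | h
  with toeplitz-window n p (S ∘ suc) r
... | inj₁ k = inj₁ (≡.cong ((if S 0 then 3 ^ n else 0) +_) k)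
... | inj₂ k = inj₂ (≡.trans (≡.cong ((if S 0 then 3 ^ n else 0) +_) k) (ℕ.+-suc _ _))

last-true : ∀ N (f : ℕ → Bool) → (∀ n → N ≤ⁿ n → f n ≡ false) →
  (∀ n → ¬ T (f n)) ⊎ ∃ λ M → T (f M) × (∀ n → T (f n) → n ≤ⁿ M)
last-true zero    f h = inj₁ λ n i → ≡.subst T (h n z≤n) i
last-true (suc N) f h with f N in eq
... | true  = inj₂ (N , ≡.subst T (≡.sym eq) tt , λ n i → bounded n i)
  where
  bounded : ∀ n → T (f n) → n ≤ⁿ N
  bounded n i with ℕ.<-≤-connex N n
  ... | inj₁ N<n = ⊥-elim (≡.subst T (h n N<n) i)
  ... | inj₂ n≤N = n≤N
... | false = last-true N f λ n N≤n → below n N≤n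
  where
  below : ∀ n → N ≤ⁿ n → f n ≡ false
  below n N≤n with ℕ.m≤n⇒m<n∨m≡n N≤n
  ... | inj₁ N<n  = h n N<n
  ... | inj₂ refl = eq

-- Values of the terms in a frame algebra

module FrameTerms (em : ExcludedMiddle 0ℓ) (t : ℕ → Bool) where
  open Frame em t
  open Algebra algebra

  ∈-∨ˡ : ∀ x y {n} → n ∈ x → n ∈ x ∨ y
  ∈-∨ˡ x y i = T-either (inj₁ i)

  ∈-∨ʳ : ∀ x y {n} → n ∈ y → n ∈ x ∨ y
  ∈-∨ʳ x y {n} i = T-either {proj₁ x n} (inj₂ i)

  empty⇒ : ∀ x → (∀ n → ¬ n ∈ x) → ∀ n → n ∈ (x · 𝟙) ′
  empty⇒ x h n = ≡.subst T (≡.sym (·𝟙′≈𝟙 x h n)) tt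

  successors : Subset → Subset
  successors y = (y · y) ∧ e ′

  ∈-successors⁺ : ∀ y {p r} → p ∈ y → p ↦ suc r → suc r ∈ successors y
  ∈-successors⁺ y i h = T-pair (∈-·⁺ {y} {y} i i (ppr refl h)) tt

  ∈-successors⁻ : ∀ y {r} → r ∈ successors y → ∃ λ p → p ∈ y × p ↦ r
  ∈-successors⁻ y i with ∈-·⁻ {y} {y} (proj₁ (T-unpair i))
  ... | p , _ , i , _ , ppr refl h = p , i , h
  ... | p , _ , i , _ , pqp refl _ = p , i , loop
  ... | _ , q , _ , j , pqq refl _ = q , j , loop

  ¬0∈∧e′ : ∀ y → ¬ 0 ∈ (y ∧ e ′)
  ¬0∈∧e′ y i = proj₂ (T-unpair {proj₁ y 0} i)

  record Segment (M : ℕ) (y : Subset) : Set where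
    field
      positive : ¬ 0 ∈ y
      upper    : ∀ {n} → n ∈ y → n ≤ⁿ M
      initial  : ∀ {n} → suc n ≤ⁿ M → suc n ∈ y
  open Segment

  segment-step : ∀ {M y} → Segment (suc M) y → Segment (suc (suc M)) (successors y)
  segment-step {M} {y} s = record
    { positive = ¬0∈∧e′ (y · y)
    ; upper    = λ i → let _ , j , h = ∈-successors⁻ y i in ℕ.≤-trans (↦-bound h) (s≤s (upper s j))
    ; initial  = reach
    }
    where
    reach : ∀ {n} → suc n ≤ⁿ suc (suc M) → suc n ∈ successors y
    reach p with ℕ.m≤n⇒m<n∨m≡n p
    ... | inj₁ (s≤s q) = ∈-successors⁺ y (initial s q) loop
    ... | inj₂ refl    = ∈-successors⁺ y (initial s ℕ.≤-refl) up

  -- One step may miss M, as the edge from M + 1 to M depends on `t`. But it adds M + 2, from which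
  -- the second step reaches everything up to M by `down`, and M + 3 by `up`.
  segment-start : ∀ {M y} → suc M ∈ y → (∀ n → n ∈ y → n ≤ⁿ suc M) →
                  Segment (3 + M) (successors (successors y))
  segment-start {M} {y} top bounded = record
    { positive = ¬0∈∧e′ (successors y · successors y)
    ; upper    = λ i → let _ , j , h = ∈-successors⁻ (successors y) i
                           _ , k , l = ∈-successors⁻ y j
                       in ℕ.≤-trans (↦-bound h) (s≤s (ℕ.≤-trans (↦-bound l) (s≤s (bounded _ k))))
    ; initial  = reach
    }
    where
    2+M : 2 + M ∈ successors y
    2+M = ∈-successors⁺ y top up
    reach : ∀ {n} → suc n ≤ⁿ 3 + M → suc n ∈ successors (successors y)
    reach p with ℕ.m≤n⇒m<n∨m≡n p
    ... | inj₂ refl = ∈-successors⁺ (successors y) 2+M up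
    ... | inj₁ (s≤s q) with ℕ.m≤n⇒m<n∨m≡n q
    ...   | inj₂ refl = ∈-successors⁺ (successors y) 2+M loop
    ...   | inj₁ (s≤s r) with ℕ.m≤n⇒m<n∨m≡n r
    ...     | inj₂ refl = ∈-successors⁺ (successors y) (∈-successors⁺ y top loop) loop
    ...     | inj₁ l = ∈-successors⁺ (successors y) 2+M (down (s≤s l))

  successors-cofinite : ∀ y N → (∀ n → N ≤ⁿ n → n ∈ y) → ∀ r → suc r ∈ successors y
  successors-cofinite y N h r = ∈-successors⁺ y
    (h (N ⊔ (3 + r)) (ℕ.m≤m⊔n N (3 + r))) (down (ℕ.m≤n⊔m N (3 + r)))

  module _ (v : ℕ → Subset) (s : Term) where

    private
      ⟦_⟧ : Term → Subset
      ⟦_⟧ = eval algebra v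

    module Finite {M} (top : suc M ∈ ⟦ s ∧ₜ δ ⟧) (bounded : ∀ n → n ∈ ⟦ s ∧ₜ δ ⟧ → n ≤ⁿ suc M) where

      segments : ∀ i → Segment (3 + (i + M)) ⟦ segment s i ⟧
      segments zero    = segment-start {y = ⟦ s ∧ₜ δ ⟧} top bounded
      segments (suc i) = segment-step (segments i)

      -- The segments i and i + 1 end at the atoms 3 + i + M and 4 + i + M.
      increment⁺ : ∀ i → 4 + (i + M) ∈ ⟦ increment s i ⟧
      increment⁺ i = T-pair (initial (segments (suc i)) ℕ.≤-refl)
        (T-not λ j → ℕ.<-irrefl refl (upper (segments i) j))

      increment⁻ : ∀ i {n} → n ∈ ⟦ increment s i ⟧ → n ≡ 4 + (i + M)
      increment⁻ i {zero}  j = ⊥-elim (positive (segments (suc i)) (proj₁ (T-unpair j)))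
      increment⁻ i {suc n} j = let k , l = T-unpair j in
        ℕ.≤-antisym (upper (segments (suc i)) k) (ℕ.≰⇒> λ h → T-not⁻ l (initial (segments i) h))

      digit⁺ : ∀ i → T (t (4 + (i + M))) → ∃ (_∈ ⟦ digit s i ⟧)
      digit⁺ i h = 5 + (i + M) , T-pair
        (∈-·⁺ {⟦ increment s (suc i) ⟧} {⟦ increment s i ⟧}
          (increment⁺ (suc i)) (increment⁺ i) (pqp refl (back h)))
        (increment⁺ (suc i))

      digit⁻ : ∀ i {n} → n ∈ ⟦ digit s i ⟧ → T (t (4 + (i + M)))
      digit⁻ i j with T-unpair j
      ... | k , l with ∈-·⁻ {⟦ increment s (suc i) ⟧} {⟦ increment s i ⟧} k
      ...   | p , q , i′ , j′ , c
        with refl ← increment⁻ (suc i) i′ | refl ← increment⁻ i j′ | refl ← increment⁻ (suc i) l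
        with c
      -- The atoms are p + 1, p, p + 1; the other shapes would identify p with p + 1.
      ...   | pqp _ h = back⁻ h
      ...   | ppr h _ = ⊥-elim (ℕ.1+n≢n h)
      ...   | pqq h _ = ⊥-elim (ℕ.1+n≢n (≡.sym h))

      digits : ℕ → Bool
      digits i = t (4 + (i + M))

      -- The clauses of `exactly` for zero and successor counts share their second disjunct.
      skip : ∀ i k → (∀ n → n ∈ ⟦ closure (digit s i) ′ₜ ⟧) → (∀ n → n ∈ ⟦ exactly s i k ⟧) →
             ∀ n → n ∈ ⟦ exactly s (suc i) k ⟧
      skip i zero    h k n = T-either (inj₂ (T-pair (h n) (k n)))
      skip i (suc _) h k n = T-either (inj₂ (T-pair (h n) (k n)))

      exactly-ones : ∀ n m → m ∈ ⟦ exactly s n (ones digits n) ⟧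
      exactly-ones zero    m = tt
      exactly-ones (suc n) with digits n in eq
      ... | true  = λ m → T-either (inj₁ (T-pair
        (·𝟙-full ⟦ digit s n ⟧ (proj₂ (digit⁺ n (≡.subst T (≡.sym eq) tt))) m) (exactly-ones n m)))
      ... | false = skip n (ones digits n)
        (λ m → T-not λ i → let _ , _ , j , _ = ∈-·⁻ {⟦ digit s n ⟧} {𝟙} i in
          ≡.subst T eq (digit⁻ n j))
        (exactly-ones n)

      cohull-nonempty : 4 + M ∈ ⟦ cohull s ⟧
      cohull-nonempty = T-not λ i → ℕ.<-irrefl refl (upper (segments 0) i)

    cohull-empty : ∀ N → (∀ n → N ≤ⁿ n → n ∈ ⟦ s ∧ₜ δ ⟧) → ∀ n → ¬ n ∈ ⟦ cohull s ⟧
    cohull-empty N h (suc n) i = T-not⁻ {proj₁ ⟦ hull s ⟧ (suc n)} i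
      (successors-cofinite (successors ⟦ s ∧ₜ δ ⟧) 1
        (λ { (suc r) _ → successors-cofinite ⟦ s ∧ₜ δ ⟧ N h r }) n)

    data Shape : Set where
      empty    : (∀ n → ¬ n ∈ ⟦ s ∧ₜ δ ⟧) → Shape
      finite   : ∀ {M} → suc M ∈ ⟦ s ∧ₜ δ ⟧ → (∀ n → n ∈ ⟦ s ∧ₜ δ ⟧ → n ≤ⁿ suc M) → Shape

    shape : ∀ N → (∀ n → N ≤ⁿ n → proj₁ ⟦ s ⟧ n ≡ false) → Shape
    shape N h with last-true N (proj₁ ⟦ s ∧ₜ δ ⟧) (λ n p → ≡.cong (λ b → b ∧ᵇ _) (h n p))
    ... | inj₁ k                   = empty k
    ... | inj₂ (zero  , i , k)     = ⊥-elim (¬0∈∧e′ ⟦ s ⟧ i)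
    ... | inj₂ (suc M , i , k)     = finite i k

    cofinite : ∀ N → (∀ n → N ≤ⁿ n → proj₁ ⟦ s ⟧ n ≡ true) → ∀ n → suc N ≤ⁿ n → n ∈ ⟦ s ∧ₜ δ ⟧
    cofinite N h (suc n) p = T-pair (≡.subst T (≡.sym (h _ (ℕ.≤-trans (ℕ.n≤1+n _) p))) tt) tt

-- Frames as models of the axioms

module Model (em : ExcludedMiddle 0ℓ) (S : ℕ → Bool) (N : ℕ) where
  open Frame em (toeplitz N S)
  open FrameTerms em (toeplitz N S)
  open Algebra algebra

  satisfies : algebra ⊨ Axioms S N
  satisfies _ _ (rsa h) = Variety.toBasis RSA isRSA _ _ h
  satisfies _ _ diverse v = ·𝟙≈𝟙 (e ′) {1} tt
  satisfies _ _ proper v = full {⟦ whole ⟧} (let _ , b , K , h = v 0 in holds b K h)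
    where
    ⟦_⟧ : Term → Subset
    ⟦_⟧ = eval algebra v
    x x̄ : Term
    x = var 0
    x̄ = var 0 ′ₜ
    gaps whole : Term
    gaps  = closure (cohull x) ∨ₜ closure (cohull x̄)
    whole = integral x ∨ₜ gaps
    holds : ∀ b K → (∀ n → K ≤ⁿ n → proj₁ (v 0) n ≡ b) → ∀ n → n ∈ ⟦ whole ⟧
    -- Whichever of `x` and its complement is finite has a nonempty `cohull`, unless it has no
    -- diversity atom, in which case `integral` holds.
    holds false K h n with shape v x K h
    ... | empty k    = ∈-∨ˡ ⟦ integral x ⟧ ⟦ gaps ⟧
      (∈-∨ˡ ⟦ closure (x ∧ₜ δ) ′ₜ ⟧ ⟦ closure (x̄ ∧ₜ δ) ′ₜ ⟧ (empty⇒ ⟦ x ∧ₜ δ ⟧ k n))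
    ... | finite i k = ∈-∨ʳ ⟦ integral x ⟧ ⟦ gaps ⟧
      (∈-∨ˡ ⟦ closure (cohull x) ⟧ ⟦ closure (cohull x̄) ⟧
        (·𝟙-full ⟦ cohull x ⟧ (Finite.cohull-nonempty v x i k) n))
    holds true K h n with shape v x̄ K (λ n p → ≡.cong not (h n p))
    ... | empty k    = ∈-∨ˡ ⟦ integral x ⟧ ⟦ gaps ⟧
      (∈-∨ʳ ⟦ closure (x ∧ₜ δ) ′ₜ ⟧ ⟦ closure (x̄ ∧ₜ δ) ′ₜ ⟧ (empty⇒ ⟦ x̄ ∧ₜ δ ⟧ k n))
    ... | finite i k = ∈-∨ʳ ⟦ integral x ⟧ ⟦ gaps ⟧
      (∈-∨ʳ ⟦ closure (cohull x) ⟧ ⟦ closure (cohull x̄) ⟧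
        (·𝟙-full ⟦ cohull x̄ ⟧ (Finite.cohull-nonempty v x̄ i k) n))
  satisfies _ _ (window n n≤N) v = full {⟦ whole ⟧} (let _ , b , K , h = v 0 in holds b K h)
    where
    ⟦_⟧ : Term → Subset
    ⟦_⟧ = eval algebra v
    x counted whole : Term
    x       = var 0
    counted = almost x (3 ^ n) (density n S)
    whole   = improper x ∨ₜ counted
    holds : ∀ b K → (∀ n → K ≤ⁿ n → proj₁ (v 0) n ≡ b) → ∀ m → m ∈ ⟦ whole ⟧
    holds true K h m = ∈-∨ˡ ⟦ improper x ⟧ ⟦ counted ⟧
      (∈-∨ʳ ⟦ closure (x ∧ₜ δ) ′ₜ ⟧ ⟦ closure (cohull x) ′ₜ ⟧
        (empty⇒ ⟦ cohull x ⟧ (cohull-empty v x (suc K) (cofinite v x K h)) m))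
    holds false K h m with shape v x K h
    ... | empty k = ∈-∨ˡ ⟦ improper x ⟧ ⟦ counted ⟧
      (∈-∨ˡ ⟦ closure (x ∧ₜ δ) ′ₜ ⟧ ⟦ closure (cohull x) ′ₜ ⟧ (empty⇒ ⟦ x ∧ₜ δ ⟧ k m))
    -- The digits read from `x` are the entries of the sequence from `4 + M` on.
    ... | finite {M} i k = ∈-∨ʳ ⟦ improper x ⟧ ⟦ counted ⟧ (count
        (Sum.map (≡.trans shift) (≡.trans shift) (toeplitz-window n n≤N S (4 + M))))
      where
      open Finite v x i k
      shift : ones digits (3 ^ n) ≡ ones (λ i → toeplitz N S (4 + M + i)) (3 ^ n)
      shift = ones-cong (λ i → ≡.cong (toeplitz N S ∘ (4 +_)) (ℕ.+-comm i M)) (3 ^ n)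
      member : ∀ {l} → ones digits (3 ^ n) ≡ l → m ∈ ⟦ exactly x (3 ^ n) l ⟧
      member refl = exactly-ones (3 ^ n) m
      count : ones digits (3 ^ n) ≡ density n S ⊎ ones digits (3 ^ n) ≡ suc (density n S) →
              m ∈ ⟦ counted ⟧
      count (inj₁ p) =
        ∈-∨ˡ ⟦ exactly x (3 ^ n) (density n S) ⟧ ⟦ exactly x (3 ^ n) (suc (density n S)) ⟧ (member p)
      count (inj₂ p) =
        ∈-∨ʳ ⟦ exactly x (3 ^ n) (density n S) ⟧ ⟦ exactly x (3 ^ n) (suc (density n S)) ⟧ (member p)

  -- The atom 1 inside and the atom 2 outside show that this set splits `e ′`.
  single : Subset
  single = (λ { 1 → true ; _ → false }) , false , 2 , λ { (suc (suc n)) _ → refl ; (suc zero) (s≤s ()) }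

  not-integral : ¬ Id algebra (integral (var 0)) 𝟙ₜ
  not-integral h with T-or {proj₁ ((((single ∧ e ′) · 𝟙) ′)) 0} (≡.subst T (≡.sym (h (λ _ → single) 0)) tt)
  ... | inj₁ p = T-not⁻ p (·𝟙-full (single ∧ e ′) {1} tt 0)
  ... | inj₂ p = T-not⁻ p (·𝟙-full (single ′ ∧ e ′) {2} tt 0)

-- The covers

module _ (em : ∀ ℓ → ExcludedMiddle ℓ) where

  -- By compactness a derivation would use windows up to some `N` only, and the frame of
  -- `toeplitz N S` refutes it.
  Base-consistent : ∀ S → ¬ Derivable (Base S) (integral (var 0)) 𝟙ₜ
  Base-consistent S d =
    let N , d = Union.compact (Axioms S) (Axioms-suc S) d
    in Model.not-integral (em 0ℓ) S N
         (soundness (Frame.algebra (em 0ℓ) (toeplitz N S)) (Model.satisfies (em 0ℓ) S N) d)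

  open Lindenbaum (integral (var 0)) 𝟙ₜ

  theory : (ℕ → Bool) → Identities
  theory S = maximal (Base S)

  theory-consistent : ∀ S → ¬ Derivable (theory S) (integral (var 0)) 𝟙ₜ
  theory-consistent S = maximal-consistent (Base-consistent S)

  ⊨Base : ∀ S A → A ⊨ theory S → A ⊨ Base S
  ⊨Base S A h s t p = h s t (maximal-extends p)

  theory-cong : ∀ {S T} → S ≗ T → theory S ⇒ theory T
  theory-cong h = maximal-mono (λ (N , p) → N , Axioms-cong h p)
                               (λ (N , p) → N , Axioms-cong (≡.sym ∘ h) p)

  -- Otherwise the free algebra of `theory S` satisfies both sets of window identities, and ε
  -- becomes derivable.
  theory-separates : ∀ S T → Mod (theory S) ⊑ Mod (theory T) → S ≗ T
  theory-separates S T S⊑T i with S i Bool.≟ T i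
  ... | yes p = p
  ... | no S≢T = ⊥-elim (theory-consistent S (completeness (theory S)
      (incompatible F⊨S (⊨Base T F (S⊑T {F} (Free⊨ (theory S)))) (proj₁ apart) (proj₂ apart))))
    where
    F : Algebra
    F = Free (theory S)
    F⊨S : F ⊨ Base S
    F⊨S = ⊨Base S F (Free⊨ (theory S))
    open Incompatible F (Base-RSA F F⊨S)
    apart : ∃ λ n → Apart (density n S) (density n T)
    apart = densities-apart S T i S≢T

  -- The free algebra of `theory S` is nontrivial, since ε fails in it, so `A₃` inherits its
  -- identities.
  VarA₃⊑theory : ∀ S → Var A₃ ⊑ Mod (theory S)
  VarA₃⊑theory S B∈ s t h = B∈ s t (A₃-generic F isRSA diverse′
      (λ p → theory-consistent S (completeness (theory S) (trivial⇒integral F isRSA diverse′ p)))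
      {s} {t} (Free⊨ (theory S) s t h))
    where
    F : Algebra
    F = Free (theory S)
    isRSA : IsRSA F
    isRSA = Base-RSA F (⊨Base S F (Free⊨ (theory S)))
    diverse′ : Derivable (theory S) (closure δ) 𝟙ₜ
    diverse′ = derive (maximal-extends (0 , diverse))

  theory⊑RSA : ∀ S → Mod (theory S) ⊑ RSA
  theory⊑RSA S {A} h = Base-RSA A (⊨Base S A h)

  integral⊑VarA₃ : ∀ S → Mod (theory S ⊕ (integral (var 0) , 𝟙ₜ)) ⊑ Var A₃
  integral⊑VarA₃ S {A} h = integral⇒VarA₃ A (theory⊑RSA S {A} h′)
      (⊨Base S A h′ _ _ (0 , diverse) λ _ → Algebra.𝟘 A) (h _ _ (inj₂ refl))
    where
    h′ : A ⊨ theory S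
    h′ s t = h s t ∘ inj₁

  module _ (W : Variety) (RSA⊑W : RSA ⊑ W) (A₃∈W : Member W A₃) where

    VarA₃⊑W : Var A₃ ⊑ W
    VarA₃⊑W {B} = Var-least A₃ W A₃∈W {B}

    -- The same varieties serve all three lattices: covering and join-irreducibility concern only
    -- subvarieties of `Mod (theory S)`, which lies below `RSA`.
    module Cover (S : ℕ → Bool) = MaximalCover em W (Var A₃) (λ {B} → VarA₃⊑W {B}) (theory S)
      (integral (var 0)) 𝟙ₜ (λ {A} → RSA⊑W {A} ∘ theory⊑RSA S {A}) (λ {A} → VarA₃⊑theory S {A})
      (derive integral-A₃) (λ {A} → integral⊑VarA₃ S {A}) (theory-consistent S)
      (maximal-maximal (em 0ℓ))

    continuum : HasCardinalityContinuum
      (JoinIrreducibleCovers (SubvarietyLattice W) (Var A₃ , λ {B} → VarA₃⊑W {B}))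
    continuum = cantorBernstein code
      (λ {x} {y} → code-cong {x} {y}) (λ {x} {y} → code-injective {x} {y})
      (λ S → Cover.b S , Cover.covers S , Cover.joinIrreducible S)
      (λ h → (λ {A} → Mod-antitone (theory-cong (≡.sym ∘ h)) {A}) ,
             (λ {A} → Mod-antitone (theory-cong h) {A}))
      (λ {S} {T} p → theory-separates S T λ {A} → proj₁ p {A})
      where
      open Code em W (Var A₃ , λ {B} → VarA₃⊑W {B})
      open CantorBernstein (em _) S (ℕ ≡.→-setoid Bool)

theorem3p23 : (∀ ℓ → ExcludedMiddle ℓ) →
    HasCardinalityContinuum (JoinIrreducibleCovers Λ-RSA VarA₃-in-RSA) ×
    HasCardinalityContinuum (JoinIrreducibleCovers Λ-SA VarA₃-in-SA) ×
    HasCardinalityContinuum (JoinIrreducibleCovers Λ-NA VarA₃-in-NA)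
theorem3p23 em =
  continuum em RSA (λ h → h) A₃-RSA ,
  continuum em SA (λ h → IsRSA.isSA h) A₃-SA ,
  continuum em NA (λ h → IsSA.isNA (IsRSA.isSA h)) A₃-NA
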